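{- Let $m<n$ be nonnegative integers with $n\ge1$ and let $a_1,\dots,a_n$ be nonnegative integers. Then \[ \mathrm{CT}\Bigg[\prod_{1\le i<j\le n}\left(\frac{x_i}{x_j}\right)_{a_i}\left(\frac{qx_j}{x_i}\right)_{a_j^*}\Bigg]=\frac{1-q^{1+|\mathbf a|}}{1-q^{1+\sum_{v=m+1}^n a_v}}\begin{bmatrix}|\mathbf a|\\ \mathbf a\end{bmatrix}_q, \] where for a pair $i<j$ we set $a_j^*=a_n+\chi(i\le m)$ if $j=n$, and $a_j^*=a_j$ otherwise.
   Context: $q$ and $x_1,\dots,x_n$ are independent indeterminates; the expression is a Laurent polynomial in $x_1,\dots,x_n$ with coefficients in $\mathbb{Q}(q)$, and $\mathrm{CT}$ denotes its constant term with respect to $x_1,\dots,x_n$. $(t)_k=(1-t)(1-tq)\cdots(1-tq^{k-1})$ (with $(t)_0=1$). $|\mathbf a|=a_1+\dots+a_n$ and $\begin{bmatrix}|\mathbf a|\\ \mathbf a\end{bmatrix}_q=\frac{(q)_{|\mathbf a|}}{(q)_{a_1}\cdots(q)_{a_n}}$. $\chi(S)$ equals $1$ if statement $S$ is true and $0$ otherwise. -}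

module Defs where

open import Data.Nat as ℕ using (ℕ; zero; suc; _∸_; _≡ᵇ_; _<ᵇ_)
open import Data.Integer as ℤ using (ℤ; +_; -_)
open import Data.Fin using (Fin; toℕ)
open import Data.Vec as V using (Vec; []; replicate; tabulate; zipWith)
open import Data.Vec.Properties using (≡-dec)
open import Data.List as L using (List; []; _∷_; [_]; _++_; map; foldr; concatMap; allFin)
open import Data.Product using (_×_; _,_)
open import Data.Bool using (Bool; true; false; if_then_else_; _∧_)
open import Relation.Nullary.Decidable using (does)

-- A monomial  c · q^d · x^e  with c ∈ ℤ, d ∈ ℕ, e ∈ ℤ^n (exponents of x_1..x_n).
Term : ℕ → Set
Term n = ℤ × ℕ × Vec ℤ n

-- A Laurent polynomial in x_1..x_n with coefficients in ℤ[q], as a formal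
-- (unnormalised) finite sum of monomials.  Its value is only observed via `coeff`.
LPoly : ℕ → Set
LPoly n = List (Term n)

zeroExp : ∀ {n} → Vec ℤ n
zeroExp = replicate _ (+ 0)

mulT : ∀ {n} → Term n → Term n → Term n
mulT (c , d , e) (c' , d' , e') = (c ℤ.* c' , d ℕ.+ d' , zipWith ℤ._+_ e e')

oneL : ∀ {n} → LPoly n
oneL = [ (+ 1 , 0 , zeroExp) ]

_⊗_ : ∀ {n} → LPoly n → LPoly n → LPoly n
p ⊗ r = concatMap (λ s → map (mulT s) r) p

prodL : ∀ {n} → List (LPoly n) → LPoly n
prodL = foldr _⊗_ oneL

poch : ∀ {n} → Term n → ℕ → LPoly n
poch t zero = oneL
poch (c , d , e) (suc k) = poch (c , d , e) k ⊗ (oneL ++ [ (- c , d ℕ.+ k , e) ])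

coeff : ∀ {n} → LPoly n → ℕ → Vec ℤ n → ℤ
coeff p k e = foldr (λ { (c , d , e') acc →
  if does (d ℕ.≟ k) ∧ does (≡-dec ℤ._≟_ e' e) then c ℤ.+ acc else acc }) (+ 0) p

QPoly : Set
QPoly = LPoly 0

qcoeff : QPoly → ℕ → ℤ
qcoeff p k = coeff p k []

CT : ∀ {n} → LPoly n → QPoly
CT p = foldr (λ { (c , d , e) acc →
  if does (≡-dec ℤ._≟_ e zeroExp) then (c , d , []) ∷ acc else acc }) [] p

qPoch : ℕ → QPoly
qPoch k = poch (+ 1 , 1 , []) k

oneMinusQ : ℕ → QPoly
oneMinusQ k = oneL ++ [ (- (+ 1) , k , []) ]

ratio : ∀ {n} → Fin n → Fin n → Vec ℤ n
ratio i j = tabulate λ l →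
  (if toℕ l ≡ᵇ toℕ i then + 1 else + 0) ℤ.- (if toℕ l ≡ᵇ toℕ j then + 1 else + 0)

sumℕ : List ℕ → ℕ
sumℕ = foldr ℕ._+_ 0

∣_∣ : ∀ {n} → (Fin n → ℕ) → ℕ
∣ a ∣ = sumℕ (map a (allFin _))

-- sum_{v=m+1}^n a_v  (1-indexed v; 0-indexed: toℕ v ≥ m)
tailSum : ∀ {n} → ℕ → (Fin n → ℕ) → ℕ
tailSum m a = sumℕ (map (λ v → if toℕ v <ᵇ m then 0 else a v) (allFin _))

-- a_j^* for the pair i < j: a_n + χ(i ≤ m) if j = n, else a_j  (1-indexed);
-- 0-indexed: j = n  ⇔ toℕ j = n-1,  i ≤ m ⇔ toℕ i < m
astar : (n m : ℕ) → (Fin n → ℕ) → Fin n → Fin n → ℕ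
astar n m a i j =
  if toℕ j ≡ᵇ (n ∸ 1) then a j ℕ.+ (if toℕ i <ᵇ m then 1 else 0) else a j

lhs : (n m : ℕ) → (Fin n → ℕ) → LPoly n
lhs n m a = prodL (concatMap (λ i → concatMap (λ j →
  if toℕ i <ᵇ toℕ j
  then [ poch (+ 1 , 0 , ratio i j) (a i) ⊗ poch (+ 1 , 1 , ratio j i) (astar n m a i j) ]
  else []) (allFin n)) (allFin n))

{-# OPTIONS --safe #-}

-- After multiplication by x^d with d_i = |a| − a_i + χ(i ≤ m) (d_n = |a| − a_n) the expression
-- becomes a homogeneous polynomial F, and the constant term becomes the coefficient of x^d.
-- Following Károlyi and Nagy, this coefficient is extracted by Lagrange interpolation on the grid
-- x_i ∈ {q^0, …, q^(d_i)}.  At x_i = q^(α_i) the factors of F force the intervals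
-- [α_i, α_i + a_i) to be disjoint, with additional gaps whenever a larger index precedes a smaller
-- one.  The grid is so tight that F vanishes except at α_i = a_1 + … + a_(i−1), so that the
-- interpolation formula has a single term, which telescopes to the right-hand side.
--
-- Everything is evaluated at integers q ≥ 2, where powers of q are distinct; an identity in ℤ[q]
-- follows because a nonzero polynomial does not vanish at all of them.

module Submission where

open import Defs
open import Data.Bool using (Bool; true; false; if_then_else_)
open import Data.Empty using (⊥-elim)
open import Data.Fin as Fin using (Fin; zero; suc; toℕ)
import Data.Fin.Properties as Fin
open import Data.Integer as ℤ using (ℤ; +_; -_; 0ℤ; 1ℤ; _+_; _*_; _-_; _^_)
import Data.Integer.Properties as ℤ
open import Data.Integer.Tactic.RingSolver using (solve-∀)
open import Data.List using (List; []; _∷_; [_]; _++_; map; concatMap; tabulate; allFin)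
open import Data.List.Membership.Propositional using (_∈_)
open import Data.List.Membership.Propositional.Properties using (∈-allFin)
open import Data.List.Relation.Binary.Permutation.Propositional using (_↭_; ↭-sym; ↭⇒↭ₛ)
open import Data.List.Relation.Binary.Permutation.Propositional.Properties using (∈-resp-↭; map⁺)
open import Data.List.Relation.Binary.Permutation.Setoid.Properties using (Unique-resp-↭; foldr-commMonoid)
open import Data.List.Relation.Unary.All as All using (All; []; _∷_)
import Data.List.Relation.Unary.All.Properties as All
open import Data.List.Relation.Unary.AllPairs using (AllPairs; []; _∷_)
open import Data.List.Relation.Unary.Any using (here; there)
open import Data.List.Relation.Unary.Linked as Linked using (Linked; [-]; _∷_)
import Data.List.Relation.Unary.Linked.Properties as Linked
open import Data.List.Relation.Unary.Unique.Propositional.Properties using (allFin⁺)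
open import Data.List.Sort using (sort; sort-↭; sort-↗)
open import Data.Nat as ℕ using (ℕ; zero; suc; _≤_; _<_; _≡ᵇ_; _<ᵇ_)
import Data.Nat.Properties as ℕ
open import Data.Nat.Tactic.RingSolver using () renaming (solve-∀ to ℕ-solve-∀)
open import Data.Product using (_×_; _,_; proj₁; proj₂)
open import Data.Sum using (_⊎_; inj₁; inj₂)
open import Data.Unit using (⊤)
open import Data.Vec as Vec using (Vec; []; zipWith; lookup)
import Data.Vec.Functional as Vector
import Data.Vec.Properties as Vec
open import Function using (_∘_)
open import Relation.Binary using (DecTotalOrder; tri<; tri≈; tri>)
import Relation.Binary.Construct.On as On
open import Relation.Binary.PropositionalEquality using (_≡_; _≢_; refl; sym; trans; cong; cong₂; subst; subst₂; setoid; module ≡-Reasoning)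
open import Relation.Nullary using (yes; no; ¬_)
open import Relation.Nullary.Decidable using (dec-true; dec-false)
open import Algebra.Properties.CommutativeMonoid.Sum ℕ.+-0-commutativeMonoid
  using (∑-distrib-+; ∑-comm)
  renaming (sum to Σ; sum-cong-≗ to Σ-cong; sum-replicate-zero to Σ-zero)
open import Algebra.Properties.CommutativeMonoid.Sum ℤ.*-1-commutativeMonoid
  using ()
  renaming (sum to Π; sum-cong-≗ to Π-cong; sum-replicate-zero to Π-one; ∑-distrib-+ to Π-distrib-*; ∑-comm to Π-comm)

-- Evaluation of Laurent polynomials

-- The slack χ(i ≤ m) in d_i is what endangers uniqueness. Sorted by position, the intervals have
-- total length |a|, and each step to a smaller index wastes at least one unit. Since d_n + a_n =
-- |a|, there is no slack if index n comes last, and the indices must increase. Another last index l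
-- may end at |a| + 1 when l ≤ m; but then index n is followed by a smaller index, and the summand χ
-- in a_n^* makes this step waste a second unit or, failing that, a further decrease of the index
-- does. So the change in a_n^* offsets the larger degrees that it causes. No division takes place:
-- the interpolation operator is scaled to have integer weights, the theorem is stated with its
-- denominators multiplied out, and the remaining factors are cancelled as nonzero integers.

exponents : ∀ {n} → Term n → Vec ℤ n
exponents t = proj₂ (proj₂ t)

eval : ∀ {n} → ℤ → (Vec ℤ n → ℤ) → LPoly n → ℤ
eval Q φ []                = 0ℤ
eval Q φ ((c , d , e) ∷ p) = c * (Q ^ d) * φ e + eval Q φ p

eval-++ : ∀ {n} Q (φ : Vec ℤ n → ℤ) p r → eval Q φ (p ++ r) ≡ eval Q φ p + eval Q φ r
eval-++ Q φ []                r = sym (ℤ.+-identityˡ _)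
eval-++ Q φ ((c , d , e) ∷ p) r =
  trans (cong (_+_ (c * (Q ^ d) * φ e)) (eval-++ Q φ p r))
        (sym (ℤ.+-assoc (c * (Q ^ d) * φ e) (eval Q φ p) (eval Q φ r)))

-- Multiplicativity is asked only of terms satisfying `P` and `R`, because the evaluation of
-- monomials on the grid is multiplicative only on balanced exponents. For polynomials in q alone
-- both predicates are trivial.
module _ {n} (Q : ℤ) {φ ψ χ : Vec ℤ n → ℤ} {P R : Term n → Set}
  (mult : ∀ {s t} → P s → R t → χ (zipWith _+_ (exponents s) (exponents t)) ≡ φ (exponents s) * ψ (exponents t))
  where

  eval-map-mulT : ∀ {c d e r} → P (c , d , e) → All R r →
                  eval Q χ (map (mulT (c , d , e)) r) ≡ c * (Q ^ d) * φ e * eval Q ψ r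
  eval-map-mulT {c} {d} {e} Ps [] = sym (ℤ.*-zeroʳ (c * (Q ^ d) * φ e))
  eval-map-mulT {c} {d} {e} {(c' , d' , e') ∷ r} Ps (Rt ∷ Rr)
    rewrite eval-map-mulT Ps Rr | mult Ps Rt | ℤ.^-distribˡ-+-* Q d d' =
    lemma c c' (Q ^ d) (Q ^ d') (φ e) (ψ e') (eval Q ψ r)
    where
    lemma : ∀ c c' x x' f g v → c * c' * (x * x') * (f * g) + c * x * f * v
                              ≡ c * x * f * (c' * x' * g + v)
    lemma = solve-∀

  eval-⊗ : ∀ {p r} → All P p → All R r → eval Q χ (p ⊗ r) ≡ eval Q φ p * eval Q ψ r
  eval-⊗ []                                 Rr = refl
  eval-⊗ {(c , d , e) ∷ p} {r} (Ps ∷ Pp) Rr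
    rewrite eval-++ Q χ (map (mulT (c , d , e)) r) (p ⊗ r) | eval-⊗ Pp Rr | eval-map-mulT Ps Rr =
    sym (ℤ.*-distribʳ-+ (eval Q ψ r) (c * (Q ^ d) * φ e) (eval Q φ p))

evalq : ℤ → QPoly → ℤ
evalq Q = eval Q (λ _ → 1ℤ)

evalq-⊗ : ∀ Q p r → evalq Q (p ⊗ r) ≡ evalq Q p * evalq Q r
evalq-⊗ Q p r = eval-⊗ Q {P = λ _ → ⊤} {R = λ _ → ⊤} (λ _ _ → refl) (All.universal _ p) (All.universal _ r)

-- Polynomial identities in q from evaluations at integers

addAt : ℕ → ℤ → List ℤ → List ℤ
addAt zero    c []       = c ∷ []
addAt zero    c (x ∷ xs) = c + x ∷ xs
addAt (suc d) c []       = 0ℤ ∷ addAt d c []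
addAt (suc d) c (x ∷ xs) = x ∷ addAt d c xs

dense : QPoly → List ℤ
dense []                = []
dense ((c , d , e) ∷ p) = addAt d c (dense p)

nth : List ℤ → ℕ → ℤ
nth []       k       = 0ℤ
nth (x ∷ xs) zero    = x
nth (x ∷ xs) (suc k) = nth xs k

horner : ℤ → List ℤ → ℤ
horner Q []       = 0ℤ
horner Q (x ∷ xs) = x + Q * horner Q xs

subtract : List ℤ → List ℤ → List ℤ
subtract []       ys       = map -_ ys
subtract (x ∷ xs) []       = x ∷ xs
subtract (x ∷ xs) (y ∷ ys) = x - y ∷ subtract xs ys

nth-addAt : ∀ d c xs k → nth (addAt d c xs) k ≡ (if d ≡ᵇ k then c + nth xs k else nth xs k)
nth-addAt zero    c []       zero    = sym (ℤ.+-identityʳ c)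
nth-addAt zero    c []       (suc k) = refl
nth-addAt zero    c (x ∷ xs) zero    = refl
nth-addAt zero    c (x ∷ xs) (suc k) = refl
nth-addAt (suc d) c []       zero    = refl
nth-addAt (suc d) c []       (suc k) = nth-addAt d c [] k
nth-addAt (suc d) c (x ∷ xs) zero    = refl
nth-addAt (suc d) c (x ∷ xs) (suc k) = nth-addAt d c xs k

horner-addAt : ∀ Q d c xs → horner Q (addAt d c xs) ≡ c * (Q ^ d) + horner Q xs
horner-addAt Q zero    c []       = lemma c Q
  where
  lemma : ∀ c Q → c + Q * 0ℤ ≡ c * 1ℤ + 0ℤ
  lemma = solve-∀
horner-addAt Q zero    c (x ∷ xs) = lemma c x (Q * horner Q xs)
  where
  lemma : ∀ c x v → c + x + v ≡ c * 1ℤ + (x + v)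
  lemma = solve-∀
horner-addAt Q (suc d) c []       rewrite horner-addAt Q d c [] = lemma c Q (Q ^ d)
  where
  lemma : ∀ c Q z → 0ℤ + Q * (c * z + 0ℤ) ≡ c * (Q * z) + 0ℤ
  lemma = solve-∀
horner-addAt Q (suc d) c (x ∷ xs) rewrite horner-addAt Q d c xs = lemma c Q (Q ^ d) x (horner Q xs)
  where
  lemma : ∀ c Q z x v → x + Q * (c * z + v) ≡ c * (Q * z) + (x + Q * v)
  lemma = solve-∀

nth-map-neg : ∀ ys k → nth (map -_ ys) k ≡ - nth ys k
nth-map-neg []       k       = refl
nth-map-neg (y ∷ ys) zero    = refl
nth-map-neg (y ∷ ys) (suc k) = nth-map-neg ys k

nth-subtract : ∀ xs ys k → nth (subtract xs ys) k ≡ nth xs k - nth ys k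
nth-subtract []       ys       k       = trans (nth-map-neg ys k) (sym (ℤ.+-identityˡ _))
nth-subtract (x ∷ xs) []       k       = sym (ℤ.+-identityʳ _)
nth-subtract (x ∷ xs) (y ∷ ys) zero    = refl
nth-subtract (x ∷ xs) (y ∷ ys) (suc k) = nth-subtract xs ys k

horner-map-neg : ∀ Q ys → horner Q (map -_ ys) ≡ - horner Q ys
horner-map-neg Q []       = refl
horner-map-neg Q (y ∷ ys) rewrite horner-map-neg Q ys = lemma Q y (horner Q ys)
  where
  lemma : ∀ Q y v → - y + Q * (- v) ≡ - (y + Q * v)
  lemma = solve-∀

horner-subtract : ∀ Q xs ys → horner Q (subtract xs ys) ≡ horner Q xs - horner Q ys
horner-subtract Q []       ys       = trans (horner-map-neg Q ys) (sym (ℤ.+-identityˡ _))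
horner-subtract Q (x ∷ xs) []       = sym (ℤ.+-identityʳ _)
horner-subtract Q (x ∷ xs) (y ∷ ys) rewrite horner-subtract Q xs ys = lemma Q x y (horner Q xs) (horner Q ys)
  where
  lemma : ∀ Q x y v w → x - y + Q * (v - w) ≡ (x + Q * v) - (y + Q * w)
  lemma = solve-∀

horner-dense : ∀ Q p → horner Q (dense p) ≡ evalq Q p
horner-dense Q []                = refl
horner-dense Q ((c , d , e) ∷ p) =
  trans (horner-addAt Q d c (dense p)) (cong₂ _+_ (sym (ℤ.*-identityʳ (c * (Q ^ d)))) (horner-dense Q p))

nth-dense : ∀ p k → nth (dense p) k ≡ qcoeff p k
nth-dense []                 k = refl
nth-dense ((c , d , []) ∷ p) k rewrite nth-addAt d c (dense p) k | nth-dense p k with d ≡ᵇ k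
... | true  = refl
... | false = refl

-- The multiplier exceeds ∣ c ∣, which forces h = 0.
constant-zero : ∀ c h → c + + (2 ℕ.+ ℤ.∣ c ∣) * h ≡ 0ℤ → c ≡ 0ℤ
constant-zero c h eq = cases ℤ.∣ h ∣ refl
  where
  Q : ℤ
  Q = + (2 ℕ.+ ℤ.∣ c ∣)
  neg-eq : c ≡ - (Q * h)
  neg-eq = ℤ.i-j≡0⇒i≡j c (- (Q * h)) (trans (cong (λ v → c + v) (ℤ.neg-involutive (Q * h))) eq)
  abs-eq : ℤ.∣ c ∣ ≡ (2 ℕ.+ ℤ.∣ c ∣) ℕ.* ℤ.∣ h ∣
  abs-eq = trans (cong ℤ.∣_∣ neg-eq) (trans (ℤ.∣-i∣≡∣i∣ (Q * h)) (ℤ.abs-* Q h))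
  cases : ∀ k → ℤ.∣ h ∣ ≡ k → c ≡ 0ℤ
  cases zero    ∣h∣ = ℤ.∣i∣≡0⇒i≡0 (trans abs-eq (trans (cong ((2 ℕ.+ ℤ.∣ c ∣) ℕ.*_) ∣h∣) (ℕ.*-zeroʳ (2 ℕ.+ ℤ.∣ c ∣))))
  cases (suc k) ∣h∣ = ⊥-elim (ℕ.<⇒≢ too-big (trans abs-eq (cong ((2 ℕ.+ ℤ.∣ c ∣) ℕ.*_) ∣h∣)))
    where
    too-big : ℤ.∣ c ∣ ℕ.< (2 ℕ.+ ℤ.∣ c ∣) ℕ.* suc k
    too-big = ℕ.≤-trans (ℕ.n≤1+n _) (ℕ.m≤m*n (2 ℕ.+ ℤ.∣ c ∣) (suc k))

-- Instead of counting roots, the evaluation point depends on the coefficient: `2 + ∣ x ∣` forces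
-- the constant coefficient `x` to vanish. Then q divides out, and the tail satisfies the same
-- hypothesis.
horner-zero : ∀ xs → (∀ z → horner (+ (2 ℕ.+ z)) xs ≡ 0ℤ) → ∀ k → nth xs k ≡ 0ℤ
horner-zero []       vanish k = refl
horner-zero (x ∷ xs) vanish k with constant-zero x _ (vanish ℤ.∣ x ∣)
... | refl = go k
  where
  tail-vanish : ∀ z → horner (+ (2 ℕ.+ z)) xs ≡ 0ℤ
  tail-vanish z with ℤ.i*j≡0⇒i≡0∨j≡0 (+ (2 ℕ.+ z)) (trans (sym (ℤ.+-identityˡ _)) (vanish z))
  ... | inj₂ eq = eq
  go : ∀ k → nth (0ℤ ∷ xs) k ≡ 0ℤ
  go zero    = refl
  go (suc k) = horner-zero xs tail-vanish k

evalq-injective : ∀ p r → (∀ z → evalq (+ (2 ℕ.+ z)) p ≡ evalq (+ (2 ℕ.+ z)) r) → ∀ k → qcoeff p k ≡ qcoeff r k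
evalq-injective p r eq k =
  trans (sym (nth-dense p k)) (trans (ℤ.i-j≡0⇒i≡j _ _ diff) (nth-dense r k))
  where
  vanish : ∀ z → horner (+ (2 ℕ.+ z)) (subtract (dense p) (dense r)) ≡ 0ℤ
  vanish z = trans (horner-subtract (+ (2 ℕ.+ z)) (dense p) (dense r))
             (ℤ.i≡j⇒i-j≡0 (trans (horner-dense _ p) (trans (eq z) (sym (horner-dense _ r)))))
  diff : nth (dense p) k - nth (dense r) k ≡ 0ℤ
  diff = trans (sym (nth-subtract (dense p) (dense r) k)) (horner-zero (subtract (dense p) (dense r)) vanish k)

-- Interpolation at powers of q

module Interpolation (Q : ℤ) where

  -- The homogenised q-Pochhammer symbol: q^(kx) times (q^(y-x))_k, written without negative
  -- exponents. In particular `qProd k 0 1` is (q)_k.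
  qProd : ℕ → ℕ → ℕ → ℤ
  qProd zero    x y = 1ℤ
  qProd (suc k) x y = qProd k x y * (Q ^ x - Q ^ (y ℕ.+ k))

  qProd-+ : ∀ j k x y → qProd (j ℕ.+ k) x y ≡ qProd j x y * qProd k x (y ℕ.+ j)
  qProd-+ j zero    x y rewrite ℕ.+-identityʳ j = sym (ℤ.*-identityʳ (qProd j x y))
  qProd-+ j (suc k) x y rewrite ℕ.+-suc j k | qProd-+ j k x y | ℕ.+-assoc y j k =
    ℤ.*-assoc (qProd j x y) (qProd k x (y ℕ.+ j)) (Q ^ x - Q ^ (y ℕ.+ (j ℕ.+ k)))

  qProd-shift : ∀ s k x y → qProd k (s ℕ.+ x) (s ℕ.+ y) ≡ (Q ^ s) ^ k * qProd k x y
  qProd-shift s zero    x y = refl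
  qProd-shift s (suc k) x y
    rewrite qProd-shift s k x y | ℕ.+-assoc s y k
          | ℤ.^-distribˡ-+-* Q s x | ℤ.^-distribˡ-+-* Q s (y ℕ.+ k) =
    lemma ((Q ^ s) ^ k) (qProd k x y) (Q ^ s) (Q ^ x) (Q ^ (y ℕ.+ k))
    where
    lemma : ∀ b v a x y → b * v * (a * x - a * y) ≡ a * b * (v * (x - y))
    lemma = solve-∀

  qProd-zero : ∀ k {x y} → y ℕ.≤ x → x ℕ.< y ℕ.+ k → qProd k x y ≡ 0ℤ
  qProd-zero zero    {x} {y} y≤x x<y rewrite ℕ.+-identityʳ y = ⊥-elim (ℕ.<⇒≱ x<y y≤x)
  qProd-zero (suc k) {x} {y} y≤x x<y+1+k with ℕ.m≤n⇒m<n∨m≡n (ℕ.≤-pred (subst (x ℕ.<_) (ℕ.+-suc y k) x<y+1+k))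
  ... | inj₁ x<y+k rewrite qProd-zero k y≤x x<y+k = refl
  ... | inj₂ refl  rewrite ℤ.+-inverseʳ (Q ^ (y ℕ.+ k)) = ℤ.*-zeroʳ (qProd k (y ℕ.+ k) y)

  qProd-suc-diagonal : ∀ k → qProd (suc k) (suc k) 0 ≡ (Q * Q ^ k - 1ℤ) * (Q ^ k * qProd k k 0)
  qProd-suc-diagonal k = begin
    qProd (1 ℕ.+ k) (suc k) 0                      ≡⟨ qProd-+ 1 k (suc k) 0 ⟩
    1ℤ * (Q * Q ^ k - 1ℤ) * qProd k (suc k) 1      ≡⟨ cong (1ℤ * (Q * Q ^ k - 1ℤ) *_) (qProd-shift 1 k k 0) ⟩
    1ℤ * (Q * Q ^ k - 1ℤ) * ((Q * 1ℤ) ^ k * qProd k k 0) ≡⟨ cong₂ (λ u v → u * (v ^ k * qProd k k 0)) (ℤ.*-identityˡ (Q * Q ^ k - 1ℤ)) (ℤ.*-identityʳ Q) ⟩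
    (Q * Q ^ k - 1ℤ) * (Q ^ k * qProd k k 0) ∎
    where open ≡-Reasoning

  -- The composite of the operators f ↦ (k ↦ f (k + 1) − q^j f k) for j < d, evaluated at 0;
  -- on f k = y^k it gives ∏_{j<d} (y − q^j).
  diff : ℕ → (ℕ → ℤ) → ℤ
  diff zero    f = f 0
  diff (suc d) f = diff d (f ∘ suc) - Q ^ d * diff d f

  diff-cong : ∀ d {f g : ℕ → ℤ} → (∀ k → f k ≡ g k) → diff d f ≡ diff d g
  diff-cong zero    eq = eq 0
  diff-cong (suc d) eq = cong₂ (λ u v → u - Q ^ d * v) (diff-cong d (eq ∘ suc)) (diff-cong d eq)

  diff-+ : ∀ d f g → diff d (λ k → f k + g k) ≡ diff d f + diff d g
  diff-+ zero    f g = refl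
  diff-+ (suc d) f g rewrite diff-+ d f g | diff-+ d (f ∘ suc) (g ∘ suc) =
    lemma (Q ^ d) (diff d (f ∘ suc)) (diff d (g ∘ suc)) (diff d f) (diff d g)
    where
    lemma : ∀ c x y u v → (x + y) - c * (u + v) ≡ (x - c * u) + (y - c * v)
    lemma = solve-∀

  diff-* : ∀ d c f → diff d (λ k → c * f k) ≡ c * diff d f
  diff-* zero    c f = refl
  diff-* (suc d) c f rewrite diff-* d c f | diff-* d c (f ∘ suc) =
    lemma c (Q ^ d) (diff d (f ∘ suc)) (diff d f)
    where
    lemma : ∀ c b x u → c * x - b * (c * u) ≡ c * (x - b * u)
    lemma = solve-∀

  -- On the nodes q^k the monomial x^E is a geometric sequence of ratio q^E, an eigenvector of the
  -- shift. The resulting product has a zero factor when E < d, so `diff d` annihilates all lower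
  -- degrees.
  diff-power : ∀ d E → diff d (λ k → Q ^ (k ℕ.* E)) ≡ qProd d E 0
  diff-power zero    E = refl
  diff-power (suc d) E = begin
    diff d (λ k → Q ^ (E ℕ.+ k ℕ.* E)) - Q ^ d * diff d (λ k → Q ^ (k ℕ.* E))
      ≡⟨ cong (λ v → v - Q ^ d * diff d (λ k → Q ^ (k ℕ.* E))) (diff-cong d (λ k → ℤ.^-distribˡ-+-* Q E (k ℕ.* E))) ⟩
    diff d (λ k → Q ^ E * Q ^ (k ℕ.* E)) - Q ^ d * diff d (λ k → Q ^ (k ℕ.* E))
      ≡⟨ cong (λ v → v - Q ^ d * diff d (λ k → Q ^ (k ℕ.* E))) (diff-* d (Q ^ E) (λ k → Q ^ (k ℕ.* E))) ⟩
    Q ^ E * diff d (λ k → Q ^ (k ℕ.* E)) - Q ^ d * diff d (λ k → Q ^ (k ℕ.* E))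
      ≡⟨ cong (λ v → Q ^ E * v - Q ^ d * v) (diff-power d E) ⟩
    Q ^ E * qProd d E 0 - Q ^ d * qProd d E 0
      ≡⟨ lemma (Q ^ E) (Q ^ d) (qProd d E 0) ⟩
    qProd d E 0 * (Q ^ E - Q ^ d) ∎
    where
    open ≡-Reasoning
    lemma : ∀ x y v → x * v - y * v ≡ v * (x - y)
    lemma = solve-∀

  diff-zero : ∀ d {f : ℕ → ℤ} → (∀ k → k ℕ.≤ d → f k ≡ 0ℤ) → diff d f ≡ 0ℤ
  diff-zero zero    f≡0 = f≡0 0 ℕ.z≤n
  diff-zero (suc d) {f} f≡0
    rewrite diff-zero d {f ∘ suc} (λ k k≤d → f≡0 (suc k) (ℕ.s≤s k≤d))
          | diff-zero d {f} (λ k k≤d → f≡0 k (ℕ.m≤n⇒m≤1+n k≤d)) =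
    lemma (Q ^ d)
    where
    lemma : ∀ x → 0ℤ - x * 0ℤ ≡ 0ℤ
    lemma = solve-∀

  -- The coefficient of y^k in ∏_{j<d} (y - q^j), hence the coefficient of `f k` in `diff d f`. Up
  -- to sign and a power of q it is a Gaussian binomial coefficient.
  weight : ℕ → ℕ → ℤ
  weight zero    zero    = 1ℤ
  weight zero    (suc k) = 0ℤ
  weight (suc d) zero    = - (Q ^ d * weight d zero)
  weight (suc d) (suc k) = weight d k - Q ^ d * weight d (suc k)

  diff-support : ∀ d s {f : ℕ → ℤ} → (∀ k → k ℕ.≤ d → k ≢ s → f k ≡ 0ℤ) → diff d f ≡ weight d s * f s
  diff-support zero    zero    {f} f≡0 = sym (ℤ.*-identityˡ (f 0))
  diff-support zero    (suc s) {f} f≡0 = f≡0 0 ℕ.z≤n (λ ())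
  diff-support (suc d) zero    {f} f≡0
    rewrite diff-zero d {f ∘ suc} (λ k k≤d → f≡0 (suc k) (ℕ.s≤s k≤d) (λ ()))
          | diff-support d zero {f} (λ k k≤d → f≡0 k (ℕ.m≤n⇒m≤1+n k≤d)) =
    lemma (Q ^ d) (weight d 0) (f 0)
    where
    lemma : ∀ x y v → 0ℤ - x * (y * v) ≡ - (x * y) * v
    lemma = solve-∀
  diff-support (suc d) (suc s) {f} f≡0
    rewrite diff-support d s {f ∘ suc} (λ k k≤d k≢s → f≡0 (suc k) (ℕ.s≤s k≤d) (k≢s ∘ ℕ.suc-injective))
          | diff-support d (suc s) {f} (λ k k≤d → f≡0 k (ℕ.m≤n⇒m≤1+n k≤d)) =
    lemma (Q ^ d) (weight d s) (weight d (suc s)) (f (suc s))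
    where
    lemma : ∀ x y z v → y * v - x * (z * v) ≡ (y - x * z) * v
    lemma = solve-∀

  weight-above : ∀ d {k} → d ℕ.< k → weight d k ≡ 0ℤ
  weight-above zero    {suc k} d<k = refl
  weight-above (suc d) {suc k} (ℕ.s≤s d<k)
    rewrite weight-above d d<k | weight-above d (ℕ.m≤n⇒m≤1+n d<k) | ℤ.*-zeroʳ (Q ^ d) = refl

  -- Lagrange interpolation at q^0, …, q^(s+r): the weight of the node q^s is, up to the
  -- common factor, the inverse of the product of the differences to the other nodes.
  weight-value : ∀ s r → weight (s ℕ.+ r) s * (qProd s s 0 * qProd r s (suc s)) ≡ qProd (s ℕ.+ r) (s ℕ.+ r) 0
  weight-value zero zero    = refl
  weight-value zero (suc r) = begin
    - (Q ^ r * weight r 0) * (1ℤ * (qProd r 0 1 * (1ℤ - Q * Q ^ r)))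
      ≡⟨ lemma (Q * Q ^ r) (Q ^ r) (weight r 0) (qProd r 0 1) ⟩
    (Q * Q ^ r - 1ℤ) * (Q ^ r * (weight r 0 * (1ℤ * qProd r 0 1)))
      ≡⟨ cong (λ v → (Q * Q ^ r - 1ℤ) * (Q ^ r * v)) (weight-value zero r) ⟩
    (Q * Q ^ r - 1ℤ) * (Q ^ r * qProd r r 0)
      ≡⟨ qProd-suc-diagonal r ⟨
    qProd (suc r) (suc r) 0 ∎
    where
    open ≡-Reasoning
    lemma : ∀ x y w p → - (y * w) * (1ℤ * (p * (1ℤ - x))) ≡ (x - 1ℤ) * (y * (w * (1ℤ * p)))
    lemma = solve-∀
  weight-value (suc s) r = begin
    (w₀ - D * w₁) * (qProd (suc s) (suc s) 0 * qProd r (suc s) (2 ℕ.+ s))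
      ≡⟨ distr w₀ w₁ D (qProd (suc s) (suc s) 0) (qProd r (suc s) (2 ℕ.+ s)) ⟩
    w₀ * (qProd (suc s) (suc s) 0 * qProd r (suc s) (2 ℕ.+ s)) - D * (w₁ * (qProd (suc s) (suc s) 0 * qProd r (suc s) (2 ℕ.+ s)))
      ≡⟨ cong₂ (λ u v → u - D * v) first (second r) ⟩
    (Q * S - 1ℤ) * D * P - D * (Q * (S - D) * P)
      ≡⟨ collect D S P Q ⟩
    (Q * D - 1ℤ) * (D * P)
      ≡⟨ qProd-suc-diagonal (s ℕ.+ r) ⟨
    qProd (suc (s ℕ.+ r)) (suc (s ℕ.+ r)) 0 ∎
    where
    open ≡-Reasoning
    w₀ w₁ D S P : ℤ
    w₀ = weight (s ℕ.+ r) s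
    w₁ = weight (s ℕ.+ r) (suc s)
    D = Q ^ (s ℕ.+ r)
    S = Q ^ s
    P = qProd (s ℕ.+ r) (s ℕ.+ r) 0
    distr : ∀ a b d x y → (a - d * b) * (x * y) ≡ a * (x * y) - d * (b * (x * y))
    distr = solve-∀
    collect : ∀ d s p q → (q * s - 1ℤ) * d * p - d * (q * (s - d) * p) ≡ (q * d - 1ℤ) * (d * p)
    collect = solve-∀
    first : w₀ * (qProd (suc s) (suc s) 0 * qProd r (suc s) (2 ℕ.+ s)) ≡ (Q * S - 1ℤ) * D * P
    first = begin
      w₀ * (qProd (suc s) (suc s) 0 * qProd r (suc s) (2 ℕ.+ s))
        ≡⟨ cong₂ (λ u v → w₀ * (u * v)) (qProd-suc-diagonal s) (qProd-shift 1 r s (suc s)) ⟩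
      w₀ * ((Q * S - 1ℤ) * (S * qProd s s 0) * ((Q * 1ℤ) ^ r * qProd r s (suc s)))
        ≡⟨ cong (λ u → w₀ * ((Q * S - 1ℤ) * (S * qProd s s 0) * (u ^ r * qProd r s (suc s)))) (ℤ.*-identityʳ Q) ⟩
      w₀ * ((Q * S - 1ℤ) * (S * qProd s s 0) * (Q ^ r * qProd r s (suc s)))
        ≡⟨ shuffle w₀ (Q * S - 1ℤ) S (qProd s s 0) (Q ^ r) (qProd r s (suc s)) ⟩
      (Q * S - 1ℤ) * (S * Q ^ r) * (w₀ * (qProd s s 0 * qProd r s (suc s)))
        ≡⟨ cong₂ (λ u v → (Q * S - 1ℤ) * u * v) (sym (ℤ.^-distribˡ-+-* Q s r)) (weight-value s r) ⟩
      (Q * S - 1ℤ) * D * P ∎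
      where
      shuffle : ∀ w m s p r v → w * (m * (s * p) * (r * v)) ≡ m * (s * r) * (w * (p * v))
      shuffle = solve-∀
    -- The node q^(s+1) belongs to the grid of degree s + r only for positive r, where the induction
    -- hypothesis for `suc s` and `r − 1` applies. At r = 0 the weight and the factor S - q^(s+r)
    -- both vanish.
    second : ∀ r → weight (s ℕ.+ r) (suc s) * (qProd (suc s) (suc s) 0 * qProd r (suc s) (2 ℕ.+ s))
                 ≡ Q * (S - Q ^ (s ℕ.+ r)) * qProd (s ℕ.+ r) (s ℕ.+ r) 0
    second zero rewrite ℕ.+-identityʳ s | weight-above s {suc s} ℕ.≤-refl = vanish Q S (qProd s s 0)
      where
      vanish : ∀ q s p → 0ℤ ≡ q * (s - s) * p
      vanish = solve-∀
    second (suc r) rewrite ℕ.+-suc s r = begin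
      weight (suc s ℕ.+ r) (suc s) * (qProd (suc s) (suc s) 0 * (qProd r (suc s) (2 ℕ.+ s) * (Q * S - Q * (Q * Q ^ (s ℕ.+ r)))))
        ≡⟨ shuffle (weight (suc s ℕ.+ r) (suc s)) (qProd (suc s) (suc s) 0) (qProd r (suc s) (2 ℕ.+ s)) Q S (Q * Q ^ (s ℕ.+ r)) ⟩
      Q * (S - Q * Q ^ (s ℕ.+ r)) * (weight (suc s ℕ.+ r) (suc s) * (qProd (suc s) (suc s) 0 * qProd r (suc s) (2 ℕ.+ s)))
        ≡⟨ cong (Q * (S - Q * Q ^ (s ℕ.+ r)) *_) (weight-value (suc s) r) ⟩
      Q * (S - Q * Q ^ (s ℕ.+ r)) * qProd (suc s ℕ.+ r) (suc s ℕ.+ r) 0 ∎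
      where
      shuffle : ∀ w p v q s d → w * (p * (v * (q * s - q * d))) ≡ q * (s - d) * (w * (p * v))
      shuffle = solve-∀

  -- Interpolation in several variables

  boxDiff : ∀ {n} → (Fin n → ℕ) → ((Fin n → ℕ) → ℤ) → ℤ
  boxDiff {zero}  d G = G Vector.[]
  boxDiff {suc n} d G = diff (d zero) (λ k → boxDiff (d ∘ suc) (λ α → G (k Vector.∷ α)))

  boxDiff-cong : ∀ {n} (d : Fin n → ℕ) {G H : (Fin n → ℕ) → ℤ} → (∀ α → G α ≡ H α) → boxDiff d G ≡ boxDiff d H
  boxDiff-cong {zero}  d eq = eq Vector.[]
  boxDiff-cong {suc n} d eq = diff-cong (d zero) (λ k → boxDiff-cong (d ∘ suc) (λ α → eq (k Vector.∷ α)))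

  boxDiff-+ : ∀ {n} (d : Fin n → ℕ) G H → boxDiff d (λ α → G α + H α) ≡ boxDiff d G + boxDiff d H
  boxDiff-+ {zero}  d G H = refl
  boxDiff-+ {suc n} d G H =
    trans (diff-cong (d zero) (λ k → boxDiff-+ (d ∘ suc) (λ α → G (k Vector.∷ α)) (λ α → H (k Vector.∷ α))))
          (diff-+ (d zero) (λ k → boxDiff (d ∘ suc) (λ α → G (k Vector.∷ α))) (λ k → boxDiff (d ∘ suc) (λ α → H (k Vector.∷ α))))

  boxDiff-* : ∀ {n} (d : Fin n → ℕ) c G → boxDiff d (λ α → c * G α) ≡ c * boxDiff d G
  boxDiff-* {zero}  d c G = refl
  boxDiff-* {suc n} d c G =
    trans (diff-cong (d zero) (λ k → boxDiff-* (d ∘ suc) c (λ α → G (k Vector.∷ α))))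
          (diff-* (d zero) c (λ k → boxDiff (d ∘ suc) (λ α → G (k Vector.∷ α))))

  boxDiff-monomial : ∀ {n} (d E : Fin n → ℕ) →
                     boxDiff d (λ α → Q ^ Σ (λ l → α l ℕ.* E l)) ≡ Π (λ l → qProd (d l) (E l) 0)
  boxDiff-monomial {zero}  d E = refl
  boxDiff-monomial {suc n} d E = begin
    diff (d zero) (λ k → boxDiff (d ∘ suc) (λ α → Q ^ (k ℕ.* E zero ℕ.+ Σ (λ l → α l ℕ.* E (suc l)))))
      ≡⟨ diff-cong (d zero) inner ⟩
    diff (d zero) (λ k → rest * Q ^ (k ℕ.* E zero))
      ≡⟨ diff-* (d zero) rest (λ k → Q ^ (k ℕ.* E zero)) ⟩
    rest * diff (d zero) (λ k → Q ^ (k ℕ.* E zero))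
      ≡⟨ cong (rest *_) (diff-power (d zero) (E zero)) ⟩
    rest * qProd (d zero) (E zero) 0
      ≡⟨ ℤ.*-comm rest (qProd (d zero) (E zero) 0) ⟩
    qProd (d zero) (E zero) 0 * rest ∎
    where
    open ≡-Reasoning
    rest : ℤ
    rest = Π (λ l → qProd (d (suc l)) (E (suc l)) 0)
    inner : ∀ k → boxDiff (d ∘ suc) (λ α → Q ^ (k ℕ.* E zero ℕ.+ Σ (λ l → α l ℕ.* E (suc l)))) ≡ rest * Q ^ (k ℕ.* E zero)
    inner k = begin
      boxDiff (d ∘ suc) (λ α → Q ^ (k ℕ.* E zero ℕ.+ Σ (λ l → α l ℕ.* E (suc l))))
        ≡⟨ boxDiff-cong (d ∘ suc) (λ α → ℤ.^-distribˡ-+-* Q (k ℕ.* E zero) (Σ (λ l → α l ℕ.* E (suc l)))) ⟩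
      boxDiff (d ∘ suc) (λ α → Q ^ (k ℕ.* E zero) * Q ^ Σ (λ l → α l ℕ.* E (suc l)))
        ≡⟨ boxDiff-* (d ∘ suc) (Q ^ (k ℕ.* E zero)) (λ α → Q ^ Σ (λ l → α l ℕ.* E (suc l))) ⟩
      Q ^ (k ℕ.* E zero) * boxDiff (d ∘ suc) (λ α → Q ^ Σ (λ l → α l ℕ.* E (suc l)))
        ≡⟨ cong (Q ^ (k ℕ.* E zero) *_) (boxDiff-monomial (d ∘ suc) (E ∘ suc)) ⟩
      Q ^ (k ℕ.* E zero) * rest
        ≡⟨ ℤ.*-comm (Q ^ (k ℕ.* E zero)) rest ⟩
      rest * Q ^ (k ℕ.* E zero) ∎

  boxDiff-zero : ∀ {n} (d : Fin n → ℕ) {G : (Fin n → ℕ) → ℤ} →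
                 (∀ α → (∀ i → α i ℕ.≤ d i) → G α ≡ 0ℤ) → boxDiff d G ≡ 0ℤ
  boxDiff-zero {zero}  d G≡0 = G≡0 Vector.[] (λ ())
  boxDiff-zero {suc n} d G≡0 = diff-zero (d zero) λ k k≤d → boxDiff-zero (d ∘ suc) λ α α≤d →
    G≡0 (k Vector.∷ α) λ { zero → k≤d ; (suc i) → α≤d i }

  boxDiff-support : ∀ {n} (d s : Fin n → ℕ) V {G : (Fin n → ℕ) → ℤ} →
                    (∀ α → (∀ i → α i ℕ.≤ d i) → ¬ (∀ i → α i ≡ s i) → G α ≡ 0ℤ) →
                    (∀ α → (∀ i → α i ≡ s i) → G α ≡ V) →
                    (∀ i → s i ℕ.≤ d i) →
                    boxDiff d G ≡ Π (λ i → weight (d i) (s i)) * V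
  boxDiff-support {zero}  d s V     G≡0 G≡V s≤d = trans (G≡V Vector.[] (λ ())) (sym (ℤ.*-identityˡ V))
  boxDiff-support {suc n} d s V {G} G≡0 G≡V s≤d = begin
    diff (d zero) (λ k → boxDiff (d ∘ suc) (λ α → G (k Vector.∷ α)))
      ≡⟨ diff-support (d zero) (s zero) (λ k k≤d k≢s → boxDiff-zero (d ∘ suc) λ α α≤d →
           G≡0 (k Vector.∷ α) (λ { zero → k≤d ; (suc i) → α≤d i }) (λ eq → k≢s (eq zero))) ⟩
    weight (d zero) (s zero) * boxDiff (d ∘ suc) (λ α → G (s zero Vector.∷ α))
      ≡⟨ cong (weight (d zero) (s zero) *_) (boxDiff-support (d ∘ suc) (s ∘ suc) V
           (λ α α≤d α≢s → G≡0 (s zero Vector.∷ α) (λ { zero → s≤d zero ; (suc i) → α≤d i }) (λ eq → α≢s (eq ∘ suc)))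
           (λ α α≡s → G≡V (s zero Vector.∷ α) (λ { zero → refl ; (suc i) → α≡s i })) (s≤d ∘ suc)) ⟩
    weight (d zero) (s zero) * (Π (λ i → weight (d (suc i)) (s (suc i))) * V)
      ≡⟨ ℤ.*-assoc (weight (d zero) (s zero)) (Π (λ i → weight (d (suc i)) (s (suc i)))) V ⟨
    weight (d zero) (s zero) * Π (λ i → weight (d (suc i)) (s (suc i))) * V ∎
    where open ≡-Reasoning

-- Packing intervals

lastOf : {A : Set} → A → List A → A
lastOf x []       = x
lastOf x (y ∷ ys) = lastOf y ys

sumℕ-↭ : ∀ {xs ys} → xs ↭ ys → sumℕ xs ≡ sumℕ ys
sumℕ-↭ p = foldr-commMonoid (setoid ℕ) ℕ.+-0-isCommutativeMonoid (↭⇒↭ₛ p)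

sumℕ-tabulate : ∀ {A : Set} {n} (f : A → ℕ) (g : Fin n → A) → sumℕ (map f (tabulate g)) ≡ Σ (f ∘ g)
sumℕ-tabulate {n = zero}  f g = refl
sumℕ-tabulate {n = suc n} f g = cong (f (g zero) ℕ.+_) (sumℕ-tabulate f (g ∘ suc))

-- As `f` increases strictly along the list, comparing `f i` with `f j` decides which of the two
-- comes first.
order-preserving : ∀ {A : Set} {f g : A → ℕ} {xs} → AllPairs (λ x y → f x ℕ.< f y × g x ℕ.≤ g y) xs →
                   ∀ {i j} → i ∈ xs → j ∈ xs → f i ℕ.< f j → g i ℕ.≤ g j
order-preserving (x<xs ∷ _)  (here refl) (here refl) i<j = ℕ.≤-refl
order-preserving (x<xs ∷ _)  (here refl) (there j∈)  i<j = proj₂ (All.lookup x<xs j∈)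
order-preserving (x<xs ∷ _)  (there i∈)  (here refl) i<j = ⊥-elim (ℕ.<-asym i<j (proj₁ (All.lookup x<xs i∈)))
order-preserving (_ ∷ pairs) (there i∈)  (there j∈)  i<j = order-preserving pairs i∈ j∈ i<j

prefixSum : ∀ {n} → (Fin n → ℕ) → Fin n → ℕ
prefixSum a zero    = 0
prefixSum a (suc i) = a zero ℕ.+ prefixSum (a ∘ suc) i

suffixSum : ∀ {n} → (Fin n → ℕ) → Fin n → ℕ
suffixSum a zero    = Σ (a ∘ suc)
suffixSum a (suc i) = suffixSum (a ∘ suc) i

+-chain-≤ : ∀ x c {y s z} → x ℕ.+ c ℕ.≤ y → y ℕ.+ s ℕ.≤ z → x ℕ.+ (c ℕ.+ s) ℕ.≤ z
+-chain-≤ x c {s = s} p q = ℕ.≤-trans (ℕ.≤-reflexive (sym (ℕ.+-assoc x c s))) (ℕ.≤-trans (ℕ.+-monoˡ-≤ s p) q)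

packed-≤ : ∀ {n} (a α : Fin (suc n) → ℕ) {u} →
           (∀ i j → toℕ i ℕ.< toℕ j → α i ℕ.+ a i ℕ.≤ α j) →
           (∀ i → α i ℕ.+ a i ℕ.≤ u) → α zero ℕ.+ Σ a ℕ.≤ u
packed-≤ {zero}  a α gap α+a≤u = subst (λ v → α zero ℕ.+ v ℕ.≤ _) (sym (ℕ.+-identityʳ (a zero))) (α+a≤u zero)
packed-≤ {suc n} a α gap α+a≤u = +-chain-≤ (α zero) (a zero) (gap zero (suc zero) ℕ.z<s)
  (packed-≤ (a ∘ suc) (α ∘ suc) (λ i j i<j → gap (suc i) (suc j) (ℕ.s<s i<j)) (α+a≤u ∘ suc))

-- The total length equals the available space, so the first interval cannot start after `b` without
-- pushing the last one over the end. The others follow with `b` replaced by the end of the first.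
packed : ∀ {n} (a α : Fin n → ℕ) b → (∀ i → b ℕ.≤ α i) →
         (∀ i j → toℕ i ℕ.< toℕ j → α i ℕ.+ a i ℕ.≤ α j) →
         (∀ i → α i ℕ.+ a i ℕ.≤ b ℕ.+ Σ a) →
         ∀ i → α i ≡ b ℕ.+ prefixSum a i
packed {suc n} a α b b≤α gap α+a≤ zero    = trans (ℕ.≤-antisym (ℕ.+-cancelʳ-≤ (Σ a) (α zero) b (packed-≤ a α gap α+a≤)) (b≤α zero)) (sym (ℕ.+-identityʳ b))
packed {suc n} a α b b≤α gap α+a≤ (suc i) = trans
  (packed (a ∘ suc) (α ∘ suc) (b ℕ.+ a zero)
    (λ i → ℕ.≤-trans (ℕ.+-monoˡ-≤ (a zero) (b≤α zero)) (gap zero (suc i) ℕ.z<s))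
    (λ i j i<j → gap (suc i) (suc j) (ℕ.s<s i<j))
    (λ i → ℕ.≤-trans (α+a≤ (suc i)) (ℕ.≤-reflexive (sym (ℕ.+-assoc b (a zero) (Σ (a ∘ suc))))))
    i)
  (ℕ.+-assoc b (a zero) (prefixSum (a ∘ suc) i))

χ : ∀ {n} → ℕ → Fin n → ℕ
χ m i = if toℕ i <ᵇ m then 1 else 0

χ-yes : ∀ {n m} {i : Fin n} → toℕ i ℕ.< m → χ m i ≡ 1
χ-yes {m = m} {i} i<m rewrite dec-true (toℕ i ℕ.<? m) i<m = refl

χ-no : ∀ {n m} {i : Fin n} → ¬ (toℕ i ℕ.< m) → χ m i ≡ 0
χ-no {m = m} {i} i≮m rewrite dec-false (toℕ i ℕ.<? m) i≮m = refl

-- `b` abstracts a_j^*; `ascent` and `descent` state that no factor of F vanishes. `bounded` is the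
-- grid condition α_i ≤ d_i, rewritten by d_i + a_i = |a| + χ(i ≤ m).
module Packing {N : ℕ} (a α : Fin (suc N) → ℕ) (m : ℕ) (b : Fin (suc N) → Fin (suc N) → ℕ)
  (m≤N : m ℕ.≤ N)
  (a≤b : ∀ i j → a j ℕ.≤ b i j)
  (b-top : ∀ i → b i (Fin.fromℕ N) ≡ a (Fin.fromℕ N) ℕ.+ χ m i)
  (ascent : ∀ i j → toℕ i ℕ.< toℕ j → α i ℕ.≤ α j → α i ℕ.+ a i ℕ.≤ α j)
  (descent : ∀ i j → toℕ i ℕ.< toℕ j → α j ℕ.< α i → suc (α j ℕ.+ b i j) ℕ.≤ α i)
  (bounded : ∀ i → α i ℕ.+ a i ℕ.≤ Σ a ℕ.+ χ m i)
  where

  private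
    I : Set
    I = Fin (suc N)

    top : I
    top = Fin.fromℕ N

    -- Encodes the lexicographic order on `(α i , toℕ i)`, which works because `toℕ i ≤ N`. The
    -- tie-break matters: an interval of length 0 may share its start with another, and such
    -- neighbours must be listed as an ascent, since `descent` needs a strict inequality.
    key : I → ℕ
    key i = α i ℕ.* suc N ℕ.+ toℕ i

    key-order : DecTotalOrder _ _ _
    key-order = On.decTotalOrder ℕ.≤-decTotalOrder key

    key-< : ∀ {x y} → α x ℕ.< α y → key x ℕ.< key y
    key-< {x} {y} αx<αy = begin-strict
      α x ℕ.* suc N ℕ.+ toℕ x  <⟨ ℕ.+-monoʳ-< (α x ℕ.* suc N) (Fin.toℕ<n x) ⟩
      α x ℕ.* suc N ℕ.+ suc N  ≡⟨ ℕ.+-comm (α x ℕ.* suc N) (suc N) ⟩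
      suc (α x) ℕ.* suc N      ≤⟨ ℕ.*-monoˡ-≤ (suc N) αx<αy ⟩
      α y ℕ.* suc N            ≤⟨ ℕ.m≤m+n (α y ℕ.* suc N) (toℕ y) ⟩
      α y ℕ.* suc N ℕ.+ toℕ y  ∎
      where open ℕ.≤-Reasoning

    Step : I → I → Set
    Step x y = (toℕ x ℕ.< toℕ y × α x ℕ.+ a x ℕ.≤ α y) ⊎ (toℕ y ℕ.< toℕ x × suc (α x ℕ.+ b y x) ℕ.≤ α y)

    step : ∀ {x y} → key x ℕ.≤ key y × x ≢ y → Step x y
    step {x} {y} (kx≤ky , x≢y) with ℕ.<-cmp (toℕ x) (toℕ y)
    ... | tri< x<y _ _ = inj₁ (x<y , ascent x y x<y (ℕ.≮⇒≥ λ αy<αx → ℕ.<⇒≱ (key-< αy<αx) kx≤ky))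
    ... | tri≈ _ x≡y _ = ⊥-elim (x≢y (Fin.toℕ-injective x≡y))
    ... | tri> _ _ y<x = inj₂ (y<x , descent y x y<x (ℕ.≰⇒> λ αy≤αx →
                           ℕ.<⇒≱ (ℕ.+-mono-≤-< (ℕ.*-monoˡ-≤ (suc N) αy≤αx) y<x) kx≤ky))

    total : List I → ℕ
    total xs = sumℕ (map a xs)

    descent-gap : ∀ {x y} → suc (α x ℕ.+ b y x) ℕ.≤ α y → suc (α x) ℕ.+ a x ℕ.≤ α y
    descent-gap {x} {y} = ℕ.≤-trans (ℕ.s≤s (ℕ.+-monoʳ-≤ (α x) (a≤b y x)))

    step-gap : ∀ {x y} → Step x y → α x ℕ.+ a x ℕ.≤ α y
    step-gap (inj₁ (_ , gap)) = gap
    step-gap (inj₂ (_ , gap)) = ℕ.≤-trans (ℕ.n≤1+n _) (descent-gap gap)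

    chain-≤ : ∀ {x xs} → Linked Step (x ∷ xs) → α x ℕ.+ total (x ∷ xs) ℕ.≤ α (lastOf x xs) ℕ.+ a (lastOf x xs)
    chain-≤ {x} [-]           = ℕ.≤-reflexive (cong (α x ℕ.+_) (ℕ.+-identityʳ (a x)))
    chain-≤ {x} (st ∷ linked) = +-chain-≤ (α x) (a x) (step-gap st) (chain-≤ linked)

    -- The indices cannot increase at every step, so some step is a descent, and its gap supplies
    -- the extra unit.
    chain-< : ∀ {x xs} → Linked Step (x ∷ xs) → toℕ (lastOf x xs) ℕ.< toℕ x →
              suc (α x ℕ.+ total (x ∷ xs)) ℕ.≤ α (lastOf x xs) ℕ.+ a (lastOf x xs)
    chain-< [-] l<x = ⊥-elim (ℕ.<-irrefl refl l<x)
    chain-< {x} (inj₁ (x<y , gap) ∷ linked) l<x = +-chain-≤ (suc (α x)) (a x) (ℕ.s≤s gap) (chain-< linked (ℕ.<-trans l<x x<y))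
    chain-< {x} (inj₂ (y<x , gap) ∷ linked) l<x = +-chain-≤ (suc (α x)) (a x) (descent-gap gap) (chain-≤ linked)

    chain-ascending : ∀ {x xs} → Linked Step (x ∷ xs) →
                      Linked (λ x y → toℕ x ℕ.< toℕ y × α x ℕ.≤ α y) (x ∷ xs)
                      ⊎ suc (α x ℕ.+ total (x ∷ xs)) ℕ.≤ α (lastOf x xs) ℕ.+ a (lastOf x xs)
    chain-ascending [-] = inj₁ [-]
    chain-ascending {x} (inj₂ (y<x , gap) ∷ linked) = inj₂ (+-chain-≤ (suc (α x)) (a x) (descent-gap gap) (chain-≤ linked))
    chain-ascending {x} (inj₁ (x<y , gap) ∷ linked) with chain-ascending linked
    ... | inj₁ asc    = inj₁ ((x<y , ℕ.≤-trans (ℕ.m≤m+n (α x) (a x)) gap) ∷ asc)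
    ... | inj₂ excess = inj₂ (+-chain-≤ (suc (α x)) (a x) (ℕ.s≤s gap) excess)

    -- `χ m` is non-increasing in the index, so the inequality can fail only if `l` has the smaller
    -- index, which is the condition under which `chain-<` provides the missing unit.
    χ-bound : ∀ (l y : I) → χ m l ℕ.≤ χ m y ⊎ (toℕ l ℕ.< toℕ y × χ m l ≡ 1)
    χ-bound l y with toℕ l ℕ.<? m | toℕ y ℕ.<? m
    ... | no l≮m  | _       = inj₁ (subst (ℕ._≤ χ m y) (sym (χ-no l≮m)) ℕ.z≤n)
    ... | yes l<m | yes y<m = inj₁ (ℕ.≤-reflexive (trans (χ-yes l<m) (sym (χ-yes y<m))))
    ... | yes l<m | no y≮m  = inj₂ (ℕ.<-≤-trans l<m (ℕ.≮⇒≥ y≮m) , χ-yes l<m)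

    -- The descent from top to its successor costs one extra unit if the successor is below m;
    -- if only the last index is below m, a second descent must follow.
    chain-top : ∀ {x xs} → Linked Step (x ∷ xs) → top ∈ x ∷ xs → lastOf x xs ≢ top →
                suc (α x ℕ.+ (total (x ∷ xs) ℕ.+ χ m (lastOf x xs))) ℕ.≤ α (lastOf x xs) ℕ.+ a (lastOf x xs)
    chain-top [-] (here refl) l≢top = ⊥-elim (l≢top refl)
    chain-top {x} {y ∷ ys} (inj₁ (x<y , gap) ∷ linked) (here refl) l≢top = ⊥-elim (ℕ.<⇒≱ x<y (Fin.≤fromℕ y))
    chain-top {x} {y ∷ ys} (inj₂ (y<x , gap) ∷ linked) (here refl) l≢top with χ-bound (lastOf y ys) y
    ... | inj₁ χl≤χy = begin
        suc (α x ℕ.+ (a x ℕ.+ total (y ∷ ys) ℕ.+ χ m l))  ≤⟨ ℕ.s≤s (ℕ.+-monoʳ-≤ (α x) (ℕ.+-monoʳ-≤ (a x ℕ.+ total (y ∷ ys)) χl≤χy)) ⟩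
        suc (α x ℕ.+ (a x ℕ.+ total (y ∷ ys) ℕ.+ χ m y))  ≡⟨ cong (λ v → suc (α x ℕ.+ v)) (shuffle (a x) (total (y ∷ ys)) (χ m y)) ⟩
        suc (α x ℕ.+ (a x ℕ.+ χ m y ℕ.+ total (y ∷ ys)))  ≡⟨ cong (λ v → suc (α x ℕ.+ (v ℕ.+ total (y ∷ ys)))) (b-top y) ⟨
        suc (α x ℕ.+ (b y x ℕ.+ total (y ∷ ys)))          ≤⟨ +-chain-≤ (suc (α x)) (b y x) gap (chain-≤ linked) ⟩
        α l ℕ.+ a l ∎
      where
      open ℕ.≤-Reasoning
      l : I
      l = lastOf y ys
      shuffle : ∀ u v w → u ℕ.+ v ℕ.+ w ≡ u ℕ.+ w ℕ.+ v
      shuffle = ℕ-solve-∀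
    ... | inj₂ (l<y , χl≡1) = begin
        suc (α x ℕ.+ (a x ℕ.+ total (y ∷ ys) ℕ.+ χ m l))  ≡⟨ cong (λ v → suc (α x ℕ.+ (a x ℕ.+ total (y ∷ ys) ℕ.+ v))) χl≡1 ⟩
        suc (α x ℕ.+ (a x ℕ.+ total (y ∷ ys) ℕ.+ 1))      ≡⟨ shuffle (α x) (a x) (total (y ∷ ys)) ⟩
        suc (suc (α x)) ℕ.+ (a x ℕ.+ total (y ∷ ys))      ≤⟨ +-chain-≤ (2 ℕ.+ α x) (a x) (ℕ.s≤s (descent-gap gap)) (chain-< linked l<y) ⟩
        α l ℕ.+ a l ∎
      where
      open ℕ.≤-Reasoning
      l : I
      l = lastOf y ys
      shuffle : ∀ u v w → suc (u ℕ.+ (v ℕ.+ w ℕ.+ 1)) ≡ suc (suc u) ℕ.+ (v ℕ.+ w)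
      shuffle = ℕ-solve-∀
    chain-top {x} {y ∷ ys} (st ∷ linked) (there top∈) l≢top =
      subst (λ v → suc (α x ℕ.+ v) ℕ.≤ α (lastOf y ys) ℕ.+ a (lastOf y ys)) (sym (ℕ.+-assoc (a x) (total (y ∷ ys)) (χ m (lastOf y ys))))
        (+-chain-≤ (suc (α x)) (a x) (ℕ.s≤s (step-gap st)) (chain-top linked top∈ l≢top))

    indices : List I
    indices = sort key-order (allFin (suc N))

    indices-↭ : indices ↭ allFin (suc N)
    indices-↭ = sort-↭ key-order (allFin (suc N))

    ∈-indices : ∀ i → i ∈ indices
    ∈-indices i = ∈-resp-↭ (↭-sym indices-↭) (∈-allFin i)

    indices-linked : Linked Step indices
    indices-linked = Linked.map step (Linked.zip (sort-↗ key-order (allFin (suc N)) ,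
      Linked.AllPairs⇒Linked (Unique-resp-↭ (setoid I) (↭⇒↭ₛ (↭-sym indices-↭)) (allFin⁺ (suc N)))))

    indices-total : total indices ≡ Σ a
    indices-total = trans (sumℕ-↭ (map⁺ a indices-↭)) (sumℕ-tabulate a (λ i → i))

    no-excess : ∀ x {y z} → y ℕ.≤ z → ¬ suc (x ℕ.+ z) ℕ.≤ y
    no-excess x {z = z} y≤z p = ℕ.<⇒≱ p (ℕ.≤-trans y≤z (ℕ.m≤n+m z x))

    χ-top : χ m top ≡ 0
    χ-top = χ-no {i = top} (λ top<m → ℕ.<⇒≱ top<m (subst (m ℕ.≤_) (sym (Fin.toℕ-fromℕ N)) m≤N))

    bounded-top : α top ℕ.+ a top ℕ.≤ Σ a
    bounded-top = ℕ.≤-trans (bounded top) (ℕ.≤-reflexive (trans (cong (Σ a ℕ.+_) χ-top) (ℕ.+-identityʳ (Σ a))))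

    -- The sorted list is replaced by a variable `xs` carrying the relevant properties of `indices`,
    -- so that it can be split into head and tail.
    monotone : ∀ xs → Linked Step xs → (∀ i → i ∈ xs) → total xs ≡ Σ a → ∀ i j → toℕ i ℕ.< toℕ j → α i ℕ.≤ α j
    monotone []       linked all tot i j i<j with () ← all i
    monotone (x ∷ xs) linked all tot i j i<j with lastOf x xs Fin.≟ top
    ... | no l≢top = ⊥-elim (no-excess (α x) (bounded (lastOf x xs))
                       (subst (λ v → suc (α x ℕ.+ (v ℕ.+ χ m (lastOf x xs))) ℕ.≤ α (lastOf x xs) ℕ.+ a (lastOf x xs)) tot (chain-top linked (all top) l≢top)))
    ... | yes l≡top with chain-ascending linked
    ...   | inj₁ asc    = order-preserving (Linked.Linked⇒AllPairs
                            (λ (p , p′) (r , r′) → ℕ.<-trans p r , ℕ.≤-trans p′ r′) asc) (all i) (all j) i<j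
    ...   | inj₂ excess = ⊥-elim (no-excess (α x) bounded-top
                            (subst₂ (λ v l → suc (α x ℕ.+ v) ℕ.≤ α l ℕ.+ a l) tot l≡top excess))

    gaps : ∀ i j → toℕ i ℕ.< toℕ j → α i ℕ.+ a i ℕ.≤ α j
    gaps i j i<j = ascent i j i<j (monotone indices indices-linked ∈-indices indices-total i j i<j)

    -- Once the starts are monotone, every interval ends before that of `top` begins, and the bound
    -- for `top` has no slack. This removes χ from all the bounds.
    bounded-all : ∀ i → α i ℕ.+ a i ℕ.≤ Σ a
    bounded-all i with ℕ.m≤n⇒m<n∨m≡n (Fin.≤fromℕ i)
    ... | inj₁ i<top = ℕ.≤-trans (gaps i top i<top) (ℕ.≤-trans (ℕ.m≤m+n (α top) (a top)) bounded-top)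
    ... | inj₂ i≡top rewrite Fin.toℕ-injective {i = i} {j = top} i≡top = bounded-top

  packing-unique : ∀ i → α i ≡ prefixSum a i
  packing-unique = packed a α 0 (λ _ → ℕ.z≤n) gaps bounded-all

-- Homogenisation and extraction of the constant term

δ : ∀ {n} → Fin n → Fin n → ℕ
δ i l = if toℕ l ≡ᵇ toℕ i then 1 else 0

Σ-δ : ∀ {n} (f : Fin n → ℕ) i → Σ (λ l → f l ℕ.* δ i l) ≡ f i
Σ-δ {suc n} f zero = begin
  f zero ℕ.* 1 ℕ.+ Σ (λ l → f (suc l) ℕ.* 0)  ≡⟨ cong₂ ℕ._+_ (ℕ.*-identityʳ (f zero)) (Σ-cong (λ l → ℕ.*-zeroʳ (f (suc l)))) ⟩
  f zero ℕ.+ Σ {n} (λ _ → 0)                  ≡⟨ cong (f zero ℕ.+_) (Σ-zero n) ⟩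
  f zero ℕ.+ 0                                ≡⟨ ℕ.+-identityʳ (f zero) ⟩
  f zero ∎
  where open ≡-Reasoning
Σ-δ {suc n} f (suc i) = cong₂ ℕ._+_ (ℕ.*-zeroʳ (f zero)) (Σ-δ (f ∘ suc) i)

Σ-δ-one : ∀ {n} (i : Fin n) → Σ (δ i) ≡ 1
Σ-δ-one i = trans (Σ-cong (λ l → sym (ℕ.*-identityˡ (δ i l)))) (Σ-δ (λ _ → 1) i)

Σ-≤-≡ : ∀ {n} (f g : Fin n → ℕ) → (∀ i → f i ℕ.≤ g i) → Σ g ≡ Σ f → ∀ i → g i ≡ f i
Σ-≤-≡ {suc n} f g f≤g eq = λ { zero → head-eq ; (suc i) → Σ-≤-≡ (f ∘ suc) (g ∘ suc) (f≤g ∘ suc) tail-eq i }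
  where
  Σ-mono : ∀ {n} (f g : Fin n → ℕ) → (∀ i → f i ℕ.≤ g i) → Σ f ℕ.≤ Σ g
  Σ-mono {zero}  f g f≤g = ℕ.z≤n
  Σ-mono {suc n} f g f≤g = ℕ.+-mono-≤ (f≤g zero) (Σ-mono (f ∘ suc) (g ∘ suc) (f≤g ∘ suc))
  head-eq : g zero ≡ f zero
  head-eq = ℕ.≤-antisym (ℕ.+-cancelʳ-≤ (Σ (g ∘ suc)) (g zero) (f zero)
              (ℕ.≤-trans (ℕ.≤-reflexive eq) (ℕ.+-monoʳ-≤ (f zero) (Σ-mono (f ∘ suc) (g ∘ suc) (f≤g ∘ suc)))))
              (f≤g zero)
  tail-eq : Σ (g ∘ suc) ≡ Σ (f ∘ suc)
  tail-eq = ℕ.+-cancelˡ-≡ (f zero) _ _ (trans (cong (ℕ._+ Σ (g ∘ suc)) (sym head-eq)) eq)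

Π-zero : ∀ {n} (f : Fin n → ℤ) i → f i ≡ 0ℤ → Π f ≡ 0ℤ
Π-zero f zero    eq rewrite eq = refl
Π-zero f (suc i) eq rewrite Π-zero (f ∘ suc) i eq = ℤ.*-zeroʳ (f zero)

-- The exponents of x^u · x^e are natural numbers, with the same total degree as x^u.
record Balanced {n} (u : Fin n → ℕ) (e : Vec ℤ n) : Set where
  constructor balance
  field
    powers : Fin n → ℕ
    shift  : ∀ l → lookup e l + + u l ≡ + powers l
    degree : Σ powers ≡ Σ u
open Balanced

balanced-cong : ∀ {n} {u v : Fin n → ℕ} → (∀ l → u l ≡ v l) → ∀ {e} → Balanced u e → Balanced v e
balanced-cong u≗v {e} (balance k eq deg) =
  balance k (λ l → trans (cong (λ x → lookup e l + + x) (sym (u≗v l))) (eq l)) (trans deg (Σ-cong u≗v))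

balanced-zero : ∀ {n} (u : Fin n → ℕ) → Balanced u zeroExp
balanced-zero u = balance u (λ l → trans (cong (_+ + u l) (Vec.lookup-replicate l 0ℤ)) (ℤ.+-identityˡ (+ u l))) refl

balanced-ratio : ∀ {n} (i j : Fin n) → Balanced (δ j) (ratio i j)
balanced-ratio i j = balance (δ i) eq (trans (Σ-δ-one i) (sym (Σ-δ-one j)))
  where
  eq : ∀ l → lookup (ratio i j) l + + δ j l ≡ + δ i l
  eq l rewrite Vec.lookup∘tabulate (λ l → (if toℕ l ≡ᵇ toℕ i then + 1 else + 0) - (if toℕ l ≡ᵇ toℕ j then + 1 else + 0)) l
    with toℕ l ≡ᵇ toℕ i | toℕ l ≡ᵇ toℕ j
  ... | true  | true  = refl
  ... | true  | false = refl
  ... | false | true  = refl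
  ... | false | false = refl

balanced-+ : ∀ {n} {u v : Fin n → ℕ} {e f} → Balanced u e → Balanced v f →
             Balanced (λ l → u l ℕ.+ v l) (zipWith _+_ e f)
balanced-+ {u = u} {v} {e} {f} (balance k eq deg) (balance k′ eq′ deg′) =
  balance (λ l → k l ℕ.+ k′ l) sum-eq sum-deg
  where
  shuffle : ∀ a b c d → a + b + (c + d) ≡ (a + c) + (b + d)
  shuffle = solve-∀
  sum-eq : ∀ l → lookup (zipWith _+_ e f) l + + (u l ℕ.+ v l) ≡ + (k l ℕ.+ k′ l)
  sum-eq l = begin
    lookup (zipWith _+_ e f) l + + (u l ℕ.+ v l)   ≡⟨ cong (_+ + (u l ℕ.+ v l)) (Vec.lookup-zipWith _+_ l e f) ⟩
    lookup e l + lookup f l + (+ u l + + v l)      ≡⟨ shuffle (lookup e l) (lookup f l) (+ u l) (+ v l) ⟩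
    (lookup e l + + u l) + (lookup f l + + v l)    ≡⟨ cong₂ _+_ (eq l) (eq′ l) ⟩
    + k l + + k′ l                                 ∎
    where open ≡-Reasoning
  sum-deg : Σ (λ l → k l ℕ.+ k′ l) ≡ Σ (λ l → u l ℕ.+ v l)
  sum-deg = trans (∑-distrib-+ k k′) (trans (cong₂ ℕ._+_ deg deg′) (sym (∑-distrib-+ u v)))

module Evaluation (Q : ℤ) where
  open Interpolation Q

  -- The value of the monomial x^u · x^e at x_l = q^(α l).
  monomial : ∀ {n} → (u α : Fin n → ℕ) → Vec ℤ n → ℤ
  monomial u α e = Q ^ Σ (λ l → α l ℕ.* ℤ.∣ lookup e l + + u l ∣)

  -- The absolute value in `monomial` only serves to make it total: for balanced exponents the
  -- shifted exponents are already nonnegative.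
  monomial-value : ∀ {n} (u α : Fin n → ℕ) {e} (bal : Balanced u e) →
                   monomial u α e ≡ Q ^ Σ (λ l → α l ℕ.* powers bal l)
  monomial-value u α (balance k eq _) = cong (Q ^_) (Σ-cong (λ l → cong (λ x → α l ℕ.* ℤ.∣ x ∣) (eq l)))

  monomial-+ : ∀ {n} (u v α : Fin n → ℕ) {e f} → Balanced u e → Balanced v f →
               monomial (λ l → u l ℕ.+ v l) α (zipWith _+_ e f) ≡ monomial u α e * monomial v α f
  monomial-+ u v α {e} {f} bal@(balance k _ _) bal′@(balance k′ _ _) = begin
    monomial (λ l → u l ℕ.+ v l) α (zipWith _+_ e f)
      ≡⟨ monomial-value (λ l → u l ℕ.+ v l) α (balanced-+ bal bal′) ⟩
    Q ^ Σ (λ l → α l ℕ.* (k l ℕ.+ k′ l))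
      ≡⟨ cong (Q ^_) (trans (Σ-cong (λ l → ℕ.*-distribˡ-+ (α l) (k l) (k′ l))) (∑-distrib-+ (λ l → α l ℕ.* k l) (λ l → α l ℕ.* k′ l))) ⟩
    Q ^ (Σ (λ l → α l ℕ.* k l) ℕ.+ Σ (λ l → α l ℕ.* k′ l))
      ≡⟨ ℤ.^-distribˡ-+-* Q (Σ (λ l → α l ℕ.* k l)) (Σ (λ l → α l ℕ.* k′ l)) ⟩
    Q ^ Σ (λ l → α l ℕ.* k l) * Q ^ Σ (λ l → α l ℕ.* k′ l)
      ≡⟨ cong₂ _*_ (monomial-value u α bal) (monomial-value v α bal′) ⟨
    monomial u α e * monomial v α f ∎
    where open ≡-Reasoning

  monomial-cong : ∀ {n} {u v : Fin n → ℕ} α → (∀ l → u l ≡ v l) → ∀ e → monomial u α e ≡ monomial v α e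
  monomial-cong α u≗v e = cong (Q ^_) (Σ-cong (λ l → cong (λ x → α l ℕ.* ℤ.∣ lookup e l + + x ∣) (u≗v l)))

  eval-cong : ∀ {n} {φ ψ : Vec ℤ n → ℤ} → (∀ e → φ e ≡ ψ e) → ∀ p → eval Q φ p ≡ eval Q ψ p
  eval-cong eq []                = refl
  eval-cong eq ((c , d , e) ∷ p) = cong₂ (λ x y → c * (Q ^ d) * x + y) (eq e) (eval-cong eq p)

  -- x^u · p is a homogeneous polynomial of degree `Σ u`, and `f α` is its value at x_l = q^(α l).
  -- Keeping the degree and the value together allows F to be assembled factor by factor.
  record Homogenised {n} (u : Fin n → ℕ) (p : LPoly n) (f : (Fin n → ℕ) → ℤ) : Set where
    constructor _,_
    field
      balanced : All (λ t → Balanced u (exponents t)) p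
      value    : ∀ α → eval Q (monomial u α) p ≡ f α
  open Homogenised public

  hom-cong : ∀ {n} {u v : Fin n → ℕ} {p f g} → (∀ l → u l ≡ v l) → (∀ α → f α ≡ g α) →
             Homogenised u p f → Homogenised v p g
  hom-cong {p = p} u≗v f≗g (bal , val) =
    All.map (λ {t} → balanced-cong u≗v {exponents t}) bal ,
    λ α → trans (eval-cong (monomial-cong α (sym ∘ u≗v)) p) (trans (val α) (f≗g α))

  hom-⊗ : ∀ {n} {u v : Fin n → ℕ} {p r f g} → Homogenised u p f → Homogenised v r g →
          Homogenised (λ l → u l ℕ.+ v l) (p ⊗ r) (λ α → f α * g α)
  hom-⊗ {u = u} {v} {p} {r} (bal , val) (bal′ , val′) =
    balanced-⊗ bal bal′ ,
    λ α → trans (eval-⊗ Q (λ {s} {t} → monomial-+ u v α {exponents s} {exponents t}) bal bal′) (cong₂ _*_ (val α) (val′ α))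
    where
    balanced-⊗ : ∀ {p} → All (λ t → Balanced u (exponents t)) p → All (λ t → Balanced v (exponents t)) r →
                 All (λ t → Balanced (λ l → u l ℕ.+ v l) (exponents t)) (p ⊗ r)
    balanced-⊗ []                 bal′ = []
    balanced-⊗ {s ∷ p} (b ∷ bal) bal′ =
      All.++⁺ (All.map⁺ (All.map (λ {t} → balanced-+ {e = exponents s} {exponents t} b) bal′)) (balanced-⊗ bal bal′)

  hom-one : ∀ {n} → Homogenised {n} (λ _ → 0) oneL (λ _ → 1ℤ)
  hom-one {n} = (balanced-zero (λ _ → 0) ∷ []) , λ α →
    trans (cong (λ v → 1ℤ * 1ℤ * v + 0ℤ) (trans (monomial-value (λ _ → 0) α (balanced-zero (λ _ → 0)))
      (cong (Q ^_) (trans (Σ-cong (λ l → ℕ.*-zeroʳ (α l))) (Σ-zero n))))) refl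

  hom-binomial : ∀ {n} (i j : Fin n) d →
                 Homogenised (δ j) (oneL ++ [ (- (+ 1) , d , ratio i j) ]) (λ α → Q ^ α j - Q ^ (d ℕ.+ α i))
  hom-binomial i j d = (balanced-zero (δ j) ∷ balanced-ratio i j ∷ []) , val
    where
    open ≡-Reasoning
    lemma : ∀ x y z → 1ℤ * 1ℤ * x + (- 1ℤ * y * z + 0ℤ) ≡ x - y * z
    lemma = solve-∀
    val : ∀ α → eval Q (monomial (δ j) α) (oneL ++ [ (- (+ 1) , d , ratio i j) ]) ≡ Q ^ α j - Q ^ (d ℕ.+ α i)
    val α = begin
      1ℤ * 1ℤ * monomial (δ j) α zeroExp + (- 1ℤ * Q ^ d * monomial (δ j) α (ratio i j) + 0ℤ)
        ≡⟨ lemma (monomial (δ j) α zeroExp) (Q ^ d) (monomial (δ j) α (ratio i j)) ⟩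
      monomial (δ j) α zeroExp - Q ^ d * monomial (δ j) α (ratio i j)
        ≡⟨ cong₂ (λ x y → x - Q ^ d * y)
             (trans (monomial-value (δ j) α (balanced-zero (δ j))) (cong (Q ^_) (Σ-δ α j)))
             (trans (monomial-value (δ j) α (balanced-ratio i j)) (cong (Q ^_) (Σ-δ α i))) ⟩
      Q ^ α j - Q ^ d * Q ^ α i
        ≡⟨ cong (λ v → Q ^ α j - v) (ℤ.^-distribˡ-+-* Q d (α i)) ⟨
      Q ^ α j - Q ^ (d ℕ.+ α i) ∎

  hom-poch : ∀ {n} (i j : Fin n) d k →
             Homogenised (λ l → k ℕ.* δ j l) (poch (+ 1 , d , ratio i j) k) (λ α → qProd k (α j) (d ℕ.+ α i))
  hom-poch i j d zero    = hom-one
  hom-poch i j d (suc k) = hom-cong (λ l → ℕ.+-comm (k ℕ.* δ j l) (δ j l))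
    (λ α → cong (λ e → qProd k (α j) (d ℕ.+ α i) * (Q ^ α j - Q ^ e)) (shuffle d k (α i)))
    (hom-⊗ (hom-poch i j d k) (hom-binomial i j (d ℕ.+ k)))
    where
    shuffle : ∀ d k x → d ℕ.+ k ℕ.+ x ≡ d ℕ.+ x ℕ.+ k
    shuffle d k x = trans (ℕ.+-assoc d k x) (trans (cong (d ℕ.+_) (ℕ.+-comm k x)) (sym (ℕ.+-assoc d x k)))

  -- `u` and `f` are functions, for which pointwise agreement does not give equality. The
  -- constructors therefore leave them free and relate them to head and tail by pointwise equations.
  data HomFactors {n} (u : Fin n → ℕ) : List (LPoly n) → ((Fin n → ℕ) → ℤ) → Set where
    nil  : ∀ {f} → (∀ l → u l ≡ 0) → (∀ α → f α ≡ 1ℤ) → HomFactors u [] f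
    cons : ∀ {v w p ps f g h} → Homogenised v p g → HomFactors w ps h →
           (∀ l → u l ≡ v l ℕ.+ w l) → (∀ α → f α ≡ g α * h α) → HomFactors u (p ∷ ps) f

  hom-prodL : ∀ {n} {u : Fin n → ℕ} {ps f} → HomFactors u ps f → Homogenised u (prodL ps) f
  hom-prodL (nil u≗0 f≗1)          = hom-cong (sym ∘ u≗0) (sym ∘ f≗1) hom-one
  hom-prodL (cons hom homs u≗ f≗) = hom-cong (sym ∘ u≗) (sym ∘ f≗) (hom-⊗ hom (hom-prodL homs))

  factors-++ : ∀ {n} {u v : Fin n → ℕ} {ps rs f g} → HomFactors u ps f → HomFactors v rs g →
               HomFactors (λ l → u l ℕ.+ v l) (ps ++ rs) (λ α → f α * g α)
  factors-++ {v = v} {g = g} (nil u≗0 f≗1) homs = relabel homs (λ l → cong (ℕ._+ v l) (u≗0 l))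
      (λ α → trans (cong (_* g α) (f≗1 α)) (ℤ.*-identityˡ (g α)))
    where
    relabel : ∀ {n} {u v : Fin n → ℕ} {ps f g} → HomFactors u ps f → (∀ l → v l ≡ u l) → (∀ α → g α ≡ f α) → HomFactors v ps g
    relabel (nil u≗ f≗)            v≗u g≗f = nil (λ l → trans (v≗u l) (u≗ l)) (λ α → trans (g≗f α) (f≗ α))
    relabel (cons hom homs u≗ f≗) v≗u g≗f = cons hom homs (λ l → trans (v≗u l) (u≗ l)) (λ α → trans (g≗f α) (f≗ α))
  factors-++ {v = v} {g = g} (cons {v′} {w} {g = f₁} {f₂} hom homs u≗ f≗) homs′ = cons hom (factors-++ homs homs′)
    (λ l → trans (cong (ℕ._+ v l) (u≗ l)) (ℕ.+-assoc (v′ l) (w l) (v l)))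
    (λ α → trans (cong (_* g α) (f≗ α)) (ℤ.*-assoc (f₁ α) (f₂ α) (g α)))

  factors-concatMap : ∀ {A : Set} {n k} (F : A → List (LPoly n)) (g : Fin k → A) {u : Fin k → Fin n → ℕ}
                      {f : Fin k → (Fin n → ℕ) → ℤ} →
                      (∀ i → HomFactors (u i) (F (g i)) (f i)) →
                      HomFactors (λ l → Σ (λ i → u i l)) (concatMap F (tabulate g)) (λ α → Π (λ i → f i α))
  factors-concatMap {k = zero}  F g homs = nil (λ _ → refl) (λ _ → refl)
  factors-concatMap {k = suc k} F g homs = factors-++ (homs zero) (factors-concatMap F (g ∘ suc) (homs ∘ suc))

  factors-if : ∀ {n} (c : Bool) {u : Fin n → ℕ} {p f} → Homogenised u p f →
               HomFactors (λ l → if c then u l else 0) (if c then [ p ] else []) (λ α → if c then f α else 1ℤ)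
  factors-if true  {u} {f = f} hom = cons hom (nil {u = λ _ → 0} {f = λ _ → 1ℤ} (λ _ → refl) (λ _ → refl))
                         (λ l → sym (ℕ.+-identityʳ (u l))) (λ α → sym (ℤ.*-identityʳ (f α)))
  factors-if false hom = nil (λ _ → refl) (λ _ → refl)

  lhsDegree : (n m : ℕ) → (Fin n → ℕ) → Fin n → ℕ
  lhsDegree n m a l = Σ λ i → Σ λ j → if toℕ i <ᵇ toℕ j then a i ℕ.* δ j l ℕ.+ astar n m a i j ℕ.* δ i l else 0

  lhsValue : (n m : ℕ) (a α : Fin n → ℕ) → ℤ
  lhsValue n m a α = Π λ i → Π λ j →
    if toℕ i <ᵇ toℕ j then qProd (a i) (α j) (α i) * qProd (astar n m a i j) (α i) (suc (α j)) else 1ℤ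

  hom-lhs : ∀ n m a → Homogenised (lhsDegree n m a) (lhs n m a) (lhsValue n m a)
  hom-lhs n m a = hom-prodL (factors-concatMap _ (λ i → i) λ i → factors-concatMap _ (λ j → j) λ j →
    factors-if (toℕ i <ᵇ toℕ j) (hom-⊗ (hom-poch i j 0 (a i)) (hom-poch j i 1 (astar n m a i j))))

  boxDiff-term : ∀ {n} (d : Fin n → ℕ) {e} (bal : Balanced d e) → boxDiff d (λ α → monomial d α e) ≡ Π (λ l → qProd (d l) (powers bal l) 0)
  boxDiff-term d {e} bal = trans (boxDiff-cong d (λ α → monomial-value d α bal)) (boxDiff-monomial d (powers bal))

  boxDiff-constant : ∀ {n} (d : Fin n → ℕ) → boxDiff d (λ α → monomial d α zeroExp) ≡ Π (λ l → qProd (d l) (d l) 0)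
  boxDiff-constant d = boxDiff-term d (balanced-zero d)

  -- By homogeneity every monomial other than x^d has an exponent smaller than that of x^d.
  boxDiff-nonconstant : ∀ {n} (d : Fin n → ℕ) {e} → Balanced d e → e ≢ zeroExp → boxDiff d (λ α → monomial d α e) ≡ 0ℤ
  boxDiff-nonconstant d {e} bal@(balance k eq deg) e≢0 with Fin.any? (λ l → k l ℕ.<? d l)
  ... | yes (l , k<d) = trans (boxDiff-term d bal) (Π-zero (λ l → qProd (d l) (k l) 0) l (qProd-zero (d l) ℕ.z≤n k<d))
  ... | no none = ⊥-elim (e≢0 (begin
      e                            ≡⟨ Vec.tabulate∘lookup e ⟨
      Vec.tabulate (lookup e)      ≡⟨ Vec.tabulate-cong lookup≡0 ⟩
      Vec.tabulate (lookup zeroExp) ≡⟨ Vec.tabulate∘lookup zeroExp ⟩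
      zeroExp                      ∎))
    where
    open ≡-Reasoning
    k≗d : ∀ l → k l ≡ d l
    k≗d = Σ-≤-≡ d k (λ l → ℕ.≮⇒≥ (λ k<d → none (l , k<d))) deg
    cancel : ∀ x y → x ≡ (x + y) - y
    cancel = solve-∀
    lookup≡0 : ∀ l → lookup e l ≡ lookup zeroExp l
    lookup≡0 l = begin
      lookup e l                           ≡⟨ cancel (lookup e l) (+ d l) ⟩
      (lookup e l + + d l) - + d l         ≡⟨ cong (_- + d l) (trans (eq l) (cong +_ (k≗d l))) ⟩
      + d l - + d l                        ≡⟨ ℤ.+-inverseʳ (+ d l) ⟩
      0ℤ                                   ≡⟨ Vec.lookup-replicate l 0ℤ ⟨
      lookup zeroExp l                     ∎

  -- `boxDiff d` is linear and annihilates every term of x^d · p except the multiples of x^d, which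
  -- come from the constant term of p. The product on the right is its value on x^d.
  boxDiff-CT : ∀ {n} (d : Fin n → ℕ) {p} → All (λ t → Balanced d (exponents t)) p →
               boxDiff d (λ α → eval Q (monomial d α) p) ≡ evalq Q (CT p) * Π (λ l → qProd (d l) (d l) 0)
  boxDiff-CT d [] = boxDiff-zero d (λ _ _ → refl)
  boxDiff-CT d {(c , t , e) ∷ p} (bal ∷ bals) = begin
    boxDiff d (λ α → c * (Q ^ t) * monomial d α e + eval Q (monomial d α) p)
      ≡⟨ boxDiff-+ d (λ α → c * (Q ^ t) * monomial d α e) (λ α → eval Q (monomial d α) p) ⟩
    boxDiff d (λ α → c * (Q ^ t) * monomial d α e) + boxDiff d (λ α → eval Q (monomial d α) p)
      ≡⟨ cong₂ _+_ (boxDiff-* d (c * (Q ^ t)) (λ α → monomial d α e)) (boxDiff-CT d bals) ⟩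
    c * (Q ^ t) * boxDiff d (λ α → monomial d α e) + evalq Q (CT p) * Π (λ l → qProd (d l) (d l) 0)
      ≡⟨ split ⟩
    evalq Q (CT ((c , t , e) ∷ p)) * Π (λ l → qProd (d l) (d l) 0) ∎
    where
    open ≡-Reasoning
    constant : ∀ x y z → x * y + z * y ≡ (x * 1ℤ + z) * y
    constant = solve-∀
    nonconstant : ∀ x z → x * 0ℤ + z ≡ z
    nonconstant = solve-∀
    split : c * (Q ^ t) * boxDiff d (λ α → monomial d α e) + evalq Q (CT p) * Π (λ l → qProd (d l) (d l) 0)
            ≡ evalq Q (CT ((c , t , e) ∷ p)) * Π (λ l → qProd (d l) (d l) 0)
    split with Vec.≡-dec ℤ._≟_ e zeroExp
    ... | yes refl = trans (cong (λ v → c * (Q ^ t) * v + evalq Q (CT p) * Π (λ l → qProd (d l) (d l) 0)) (boxDiff-constant d))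
                           (constant (c * (Q ^ t)) (Π (λ l → qProd (d l) (d l) 0)) (evalq Q (CT p)))
    ... | no e≢0 = trans (cong (λ v → c * (Q ^ t) * v + evalq Q (CT p) * Π (λ l → qProd (d l) (d l) 0)) (boxDiff-nonconstant d bal e≢0))
                         (nonconstant (c * (Q ^ t)) (evalq Q (CT p) * Π (λ l → qProd (d l) (d l) 0)))

-- The degrees and the exceptional exponents

≡ᵇ-sym : ∀ m n → (m ≡ᵇ n) ≡ (n ≡ᵇ m)
≡ᵇ-sym zero    zero    = refl
≡ᵇ-sym zero    (suc n) = refl
≡ᵇ-sym (suc m) zero    = refl
≡ᵇ-sym (suc m) (suc n) = ≡ᵇ-sym m n

δ-sym : ∀ {n} (i j : Fin n) → δ i j ≡ δ j i
δ-sym i j = cong (if_then 1 else 0) (≡ᵇ-sym (toℕ j) (toℕ i))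

Σ-below : ∀ {n} (a : Fin n → ℕ) l → Σ (λ i → if toℕ i <ᵇ toℕ l then a i else 0) ≡ prefixSum a l
Σ-below {suc n} a zero    = Σ-zero n
Σ-below {suc n} a (suc l) = cong (a zero ℕ.+_) (Σ-below (a ∘ suc) l)

Σ-above : ∀ {n} (a : Fin n → ℕ) l → Σ (λ j → if toℕ l <ᵇ toℕ j then a j else 0) ≡ suffixSum a l
Σ-above {suc n} a zero    = refl
Σ-above {suc n} a (suc l) = Σ-above (a ∘ suc) l

prefix+suffix : ∀ {n} (a : Fin n → ℕ) l → prefixSum a l ℕ.+ (a l ℕ.+ suffixSum a l) ≡ Σ a
prefix+suffix {suc n} a zero    = refl
prefix+suffix {suc n} a (suc l) = trans (ℕ.+-assoc (a zero) (prefixSum (a ∘ suc) l) _) (cong (a zero ℕ.+_) (prefix+suffix (a ∘ suc) l))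

suffixSum-cong : ∀ {n} {a b : Fin n → ℕ} → (∀ i → a i ≡ b i) → ∀ l → suffixSum a l ≡ suffixSum b l
suffixSum-cong eq zero    = Σ-cong (eq ∘ suc)
suffixSum-cong eq (suc l) = suffixSum-cong (eq ∘ suc) l

-- For fixed `i`, `astar (suc N) m a i` is by definition `bump (χ m i) a`.
bump : ∀ {N} → ℕ → (Fin (suc N) → ℕ) → Fin (suc N) → ℕ
bump {N} c a j = if toℕ j ≡ᵇ N then a j ℕ.+ c else a j

Σ-bump : ∀ {N} c (a : Fin (suc N) → ℕ) → Σ (bump c a) ≡ Σ a ℕ.+ c
Σ-bump {zero}  c a = trans (ℕ.+-identityʳ (a zero ℕ.+ c)) (cong (ℕ._+ c) (sym (ℕ.+-identityʳ (a zero))))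
Σ-bump {suc N} c a = trans (cong (a zero ℕ.+_) (Σ-bump c (a ∘ suc))) (sym (ℕ.+-assoc (a zero) (Σ (a ∘ suc)) c))

prefixSum-bump : ∀ {N} c (a : Fin (suc N) → ℕ) l → prefixSum (bump c a) l ≡ prefixSum a l
prefixSum-bump         c a zero    = refl
prefixSum-bump {suc N} c a (suc l) = cong (a zero ℕ.+_) (prefixSum-bump c (a ∘ suc) l)

suffixSum-bump : ∀ {N} c (a : Fin (suc N) → ℕ) l → toℕ l ℕ.< N → suffixSum (bump c a) l ≡ suffixSum a l ℕ.+ c
suffixSum-bump {suc N} c a zero    l<N         = Σ-bump c (a ∘ suc)
suffixSum-bump {suc N} c a (suc l) (ℕ.s≤s l<N) = suffixSum-bump c (a ∘ suc) l l<N

bump-zero : ∀ {N} (a : Fin (suc N) → ℕ) j → bump 0 a j ≡ a j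
bump-zero {N} a j with toℕ j ≡ᵇ N
... | true  = ℕ.+-identityʳ (a j)
... | false = refl

bump-below : ∀ {N} c (a : Fin (suc N) → ℕ) j → toℕ j ℕ.< N → bump c a j ≡ a j
bump-below {N} c a j j<N rewrite dec-false (toℕ j ℕ.≟ N) (ℕ.<⇒≢ j<N) = refl

module _ {N m : ℕ} (m≤N : m ℕ.≤ N) (a : Fin (suc N) → ℕ) where

  -- If `toℕ l < m`, then `m ≤ N` ensures that `l` is not the last index, so the raised last entry
  -- lies in the suffix. Otherwise nothing is raised.
  suffixSum-astar : ∀ l → suffixSum (astar (suc N) m a l) l ≡ suffixSum a l ℕ.+ χ m l
  suffixSum-astar l with toℕ l ℕ.<? m
  ... | yes l<m = suffixSum-bump (χ m l) a l (ℕ.<-≤-trans l<m m≤N)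
  ... | no l≮m  = begin
    suffixSum (bump (χ m l) a) l  ≡⟨ cong (λ c → suffixSum (bump c a) l) (χ-no l≮m) ⟩
    suffixSum (bump 0 a) l        ≡⟨ suffixSum-cong (bump-zero a) l ⟩
    suffixSum a l                 ≡⟨ ℕ.+-identityʳ (suffixSum a l) ⟨
    suffixSum a l ℕ.+ 0           ≡⟨ cong (suffixSum a l ℕ.+_) (χ-no l≮m) ⟨
    suffixSum a l ℕ.+ χ m l       ∎
    where open ≡-Reasoning

  astar-diagonal : ∀ l → astar (suc N) m a l l ≡ a l
  astar-diagonal l with toℕ l ℕ.<? m
  ... | yes l<m = bump-below (χ m l) a l (ℕ.<-≤-trans l<m m≤N)
  ... | no l≮m  = trans (cong (λ c → bump c a l) (χ-no l≮m)) (bump-zero a l)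

  astar-top : ∀ i → astar (suc N) m a i (Fin.fromℕ N) ≡ a (Fin.fromℕ N) ℕ.+ χ m i
  astar-top i rewrite dec-true (toℕ (Fin.fromℕ N) ℕ.≟ N) (Fin.toℕ-fromℕ N) = refl

  a≤astar : ∀ i j → a j ℕ.≤ astar (suc N) m a i j
  a≤astar i j with toℕ j ≡ᵇ N
  ... | true  = ℕ.m≤m+n (a j) (χ m i)
  ... | false = ℕ.≤-refl

-- A pair i < j adds `a i` to the degree in x_j and `b i j` to that in x_i. Thus x_l receives the
-- prefix of `a` from the pairs ending in l and the suffix of `b l` from the pairs beginning with l.
degree-sum : ∀ {n} (a : Fin n → ℕ) (b : Fin n → Fin n → ℕ) l →
             Σ (λ i → Σ λ j → if toℕ i <ᵇ toℕ j then a i ℕ.* δ j l ℕ.+ b i j ℕ.* δ i l else 0)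
             ≡ prefixSum a l ℕ.+ suffixSum (b l) l
degree-sum {n} a b l = begin
  Σ (λ i → Σ λ j → if toℕ i <ᵇ toℕ j then a i ℕ.* δ j l ℕ.+ b i j ℕ.* δ i l else 0)
    ≡⟨ Σ-cong (λ i → trans (Σ-cong (λ j → split i j)) (∑-distrib-+ (λ j → left i j ℕ.* δ l j) (λ j → right i j ℕ.* δ l i))) ⟩
  Σ (λ i → Σ (λ j → left i j ℕ.* δ l j) ℕ.+ Σ (λ j → right i j ℕ.* δ l i))
    ≡⟨ ∑-distrib-+ (λ i → Σ (λ j → left i j ℕ.* δ l j)) (λ i → Σ (λ j → right i j ℕ.* δ l i)) ⟩
  Σ (λ i → Σ (λ j → left i j ℕ.* δ l j)) ℕ.+ Σ (λ i → Σ (λ j → right i j ℕ.* δ l i))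
    ≡⟨ cong₂ ℕ._+_ (Σ-cong (λ i → Σ-δ (left i) l)) (∑-comm (λ i j → right i j ℕ.* δ l i)) ⟩
  Σ (λ i → left i l) ℕ.+ Σ (λ j → Σ (λ i → right i j ℕ.* δ l i))
    ≡⟨ cong₂ ℕ._+_ (Σ-below a l) (trans (Σ-cong (λ j → Σ-δ (λ i → right i j) l)) (Σ-above (b l) l)) ⟩
  prefixSum a l ℕ.+ suffixSum (b l) l ∎
  where
  open ≡-Reasoning
  left right : Fin n → Fin n → ℕ
  left  i j = if toℕ i <ᵇ toℕ j then a i else 0
  right i j = if toℕ i <ᵇ toℕ j then b i j else 0
  split : ∀ i j → (if toℕ i <ᵇ toℕ j then a i ℕ.* δ j l ℕ.+ b i j ℕ.* δ i l else 0) ≡ left i j ℕ.* δ l j ℕ.+ right i j ℕ.* δ l i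
  split i j rewrite δ-sym l i | δ-sym l j with toℕ i <ᵇ toℕ j
  ... | true  = refl
  ... | false = refl

-- The surviving grid point

Π-nonzero : ∀ {n} (f : Fin n → ℤ) → (∀ i → f i ≢ 0ℤ) → Π f ≢ 0ℤ
Π-nonzero {zero}  f f≢0 = λ ()
Π-nonzero {suc n} f f≢0 eq with ℤ.i*j≡0⇒i≡0∨j≡0 (f zero) eq
... | inj₁ f₀≡0 = f≢0 zero f₀≡0
... | inj₂ Πf≡0 = Π-nonzero (f ∘ suc) (f≢0 ∘ suc) Πf≡0

*-cancel : ∀ {i j k} → k ≢ 0ℤ → i * k ≡ j * k → i ≡ j
*-cancel {i} {j} {k} k≢0 = ℤ.*-cancelʳ-≡ i j k {{ℤ.≢-nonZero k≢0}}

tailSum-Σ : ∀ {n} m (a : Fin n → ℕ) → tailSum m a ≡ Σ (λ v → if toℕ v <ᵇ m then 0 else a v)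
tailSum-Σ m a = sumℕ-tabulate (λ v → if toℕ v <ᵇ m then 0 else a v) (λ i → i)

∣∣-Σ : ∀ {n} (a : Fin n → ℕ) → ∣ a ∣ ≡ Σ a
∣∣-Σ a = sumℕ-tabulate a (λ i → i)

module Products (Q : ℤ) where
  open Interpolation Q
  open Evaluation Q

  -- The exponents of consecutive factors fill adjacent intervals, so the products join into one.
  Π-qProd-all : ∀ {n} (a : Fin n → ℕ) x y → Π (λ i → qProd (a i) x (y ℕ.+ prefixSum a i)) ≡ qProd (Σ a) x y
  Π-qProd-all {zero}  a x y = refl
  Π-qProd-all {suc n} a x y = begin
    qProd (a zero) x (y ℕ.+ 0) * Π (λ i → qProd (a (suc i)) x (y ℕ.+ (a zero ℕ.+ prefixSum (a ∘ suc) i)))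
      ≡⟨ cong₂ _*_ (cong (qProd (a zero) x) (ℕ.+-identityʳ y))
           (Π-cong (λ i → cong (qProd (a (suc i)) x) (sym (ℕ.+-assoc y (a zero) (prefixSum (a ∘ suc) i))))) ⟩
    qProd (a zero) x y * Π (λ i → qProd (a (suc i)) x (y ℕ.+ a zero ℕ.+ prefixSum (a ∘ suc) i))
      ≡⟨ cong (qProd (a zero) x y *_) (Π-qProd-all (a ∘ suc) x (y ℕ.+ a zero)) ⟩
    qProd (a zero) x y * qProd (Σ (a ∘ suc)) x (y ℕ.+ a zero)
      ≡⟨ qProd-+ (a zero) (Σ (a ∘ suc)) x y ⟨
    qProd (Σ a) x y ∎
    where open ≡-Reasoning

  Π-qProd-below : ∀ {n} (a : Fin n → ℕ) l x y →
               Π (λ i → if toℕ i <ᵇ toℕ l then qProd (a i) x (y ℕ.+ prefixSum a i) else 1ℤ) ≡ qProd (prefixSum a l) x y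
  Π-qProd-below {suc n} a zero    x y = Π-one (suc n)
  Π-qProd-below {suc n} a (suc l) x y = begin
    qProd (a zero) x (y ℕ.+ 0) * Π (λ i → if toℕ i <ᵇ toℕ l then qProd (a (suc i)) x (y ℕ.+ (a zero ℕ.+ prefixSum (a ∘ suc) i)) else 1ℤ)
      ≡⟨ cong₂ _*_ (cong (qProd (a zero) x) (ℕ.+-identityʳ y))
           (Π-cong (λ i → cong (λ v → if toℕ i <ᵇ toℕ l then qProd (a (suc i)) x v else 1ℤ) (sym (ℕ.+-assoc y (a zero) (prefixSum (a ∘ suc) i))))) ⟩
    qProd (a zero) x y * Π (λ i → if toℕ i <ᵇ toℕ l then qProd (a (suc i)) x (y ℕ.+ a zero ℕ.+ prefixSum (a ∘ suc) i) else 1ℤ)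
      ≡⟨ cong (qProd (a zero) x y *_) (Π-qProd-below (a ∘ suc) l x (y ℕ.+ a zero)) ⟩
    qProd (a zero) x y * qProd (prefixSum (a ∘ suc) l) x (y ℕ.+ a zero)
      ≡⟨ qProd-+ (a zero) (prefixSum (a ∘ suc) l) x y ⟨
    qProd (prefixSum a (suc l)) x y ∎
    where open ≡-Reasoning

  Π-qProd-above : ∀ {n} (a : Fin n → ℕ) l x y →
               Π (λ j → if toℕ l <ᵇ toℕ j then qProd (a j) x (y ℕ.+ prefixSum a j) else 1ℤ)
               ≡ qProd (suffixSum a l) x (y ℕ.+ prefixSum a l ℕ.+ a l)
  Π-qProd-above {suc n} a zero x y = begin
    1ℤ * Π (λ j → qProd (a (suc j)) x (y ℕ.+ (a zero ℕ.+ prefixSum (a ∘ suc) j)))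
      ≡⟨ ℤ.*-identityˡ (Π (λ j → qProd (a (suc j)) x (y ℕ.+ (a zero ℕ.+ prefixSum (a ∘ suc) j)))) ⟩
    Π (λ j → qProd (a (suc j)) x (y ℕ.+ (a zero ℕ.+ prefixSum (a ∘ suc) j)))
      ≡⟨ Π-cong (λ j → cong (qProd (a (suc j)) x) (regroup y (a zero) (prefixSum (a ∘ suc) j))) ⟩
    Π (λ j → qProd (a (suc j)) x (y ℕ.+ 0 ℕ.+ a zero ℕ.+ prefixSum (a ∘ suc) j))
      ≡⟨ Π-qProd-all (a ∘ suc) x (y ℕ.+ 0 ℕ.+ a zero) ⟩
    qProd (Σ (a ∘ suc)) x (y ℕ.+ 0 ℕ.+ a zero) ∎
    where
    open ≡-Reasoning
    regroup : ∀ y c s → y ℕ.+ (c ℕ.+ s) ≡ y ℕ.+ 0 ℕ.+ c ℕ.+ s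
    regroup y c s rewrite ℕ.+-identityʳ y = sym (ℕ.+-assoc y c s)
  Π-qProd-above {suc n} a (suc l) x y = begin
    1ℤ * Π (λ j → if toℕ l <ᵇ toℕ j then qProd (a (suc j)) x (y ℕ.+ (a zero ℕ.+ prefixSum (a ∘ suc) j)) else 1ℤ)
      ≡⟨ ℤ.*-identityˡ (Π (λ j → if toℕ l <ᵇ toℕ j then qProd (a (suc j)) x (y ℕ.+ (a zero ℕ.+ prefixSum (a ∘ suc) j)) else 1ℤ)) ⟩
    Π (λ j → if toℕ l <ᵇ toℕ j then qProd (a (suc j)) x (y ℕ.+ (a zero ℕ.+ prefixSum (a ∘ suc) j)) else 1ℤ)
      ≡⟨ Π-cong (λ j → cong (λ v → if toℕ l <ᵇ toℕ j then qProd (a (suc j)) x v else 1ℤ) (sym (ℕ.+-assoc y (a zero) (prefixSum (a ∘ suc) j)))) ⟩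
    Π (λ j → if toℕ l <ᵇ toℕ j then qProd (a (suc j)) x (y ℕ.+ a zero ℕ.+ prefixSum (a ∘ suc) j) else 1ℤ)
      ≡⟨ Π-qProd-above (a ∘ suc) l x (y ℕ.+ a zero) ⟩
    qProd (suffixSum (a ∘ suc) l) x (y ℕ.+ a zero ℕ.+ prefixSum (a ∘ suc) l ℕ.+ a (suc l))
      ≡⟨ cong (λ v → qProd (suffixSum (a ∘ suc) l) x (v ℕ.+ a (suc l))) (ℕ.+-assoc y (a zero) (prefixSum (a ∘ suc) l)) ⟩
    qProd (suffixSum (a ∘ suc) l) x (y ℕ.+ (a zero ℕ.+ prefixSum (a ∘ suc) l) ℕ.+ a (suc l)) ∎
    where open ≡-Reasoning

  lhsValue-cong : ∀ n m a {α β : Fin n → ℕ} → (∀ i → α i ≡ β i) → lhsValue n m a α ≡ lhsValue n m a β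
  lhsValue-cong n m a α≗β = Π-cong λ i → Π-cong λ j →
    cong₂ (λ x y → if toℕ i <ᵇ toℕ j then qProd (a i) y x * qProd (astar n m a i j) x (suc y) else 1ℤ) (α≗β i) (α≗β j)

  lhsValue-prefixSum : ∀ {N m} → m ℕ.≤ N → (a : Fin (suc N) → ℕ) → let s = prefixSum a in
    lhsValue (suc N) m a s
    ≡ Π (λ i → qProd (s i) (s i) 0) * Π (λ i → qProd (suffixSum a i ℕ.+ χ m i) (s i) (suc (s i ℕ.+ a i)))
  lhsValue-prefixSum {N} {m} m≤N a = begin
    Π (λ i → Π λ j → if toℕ i <ᵇ toℕ j then first i j * second i j else 1ℤ)
      ≡⟨ Π-cong (λ i → trans (Π-cong (split i))
           (Π-distrib-* (λ j → if toℕ i <ᵇ toℕ j then first i j else 1ℤ) (λ j → if toℕ i <ᵇ toℕ j then second i j else 1ℤ))) ⟩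
    Π (λ i → Π (λ j → if toℕ i <ᵇ toℕ j then first i j else 1ℤ) * Π (λ j → if toℕ i <ᵇ toℕ j then second i j else 1ℤ))
      ≡⟨ Π-distrib-* (λ i → Π (λ j → if toℕ i <ᵇ toℕ j then first i j else 1ℤ)) (λ i → Π (λ j → if toℕ i <ᵇ toℕ j then second i j else 1ℤ)) ⟩
    Π (λ i → Π (λ j → if toℕ i <ᵇ toℕ j then first i j else 1ℤ)) * Π (λ i → Π (λ j → if toℕ i <ᵇ toℕ j then second i j else 1ℤ))
      -- The first factors are collected by their larger index j, where the intervals of all i < j
      -- fill [0, s j). The second factors are collected by their smaller index i.
      ≡⟨ cong₂ _*_ (trans (Π-comm (λ i j → if toℕ i <ᵇ toℕ j then first i j else 1ℤ)) (Π-cong (λ j → Π-qProd-below a j (s j) 0))) (Π-cong row) ⟩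
    Π (λ i → qProd (s i) (s i) 0) * Π (λ i → qProd (suffixSum a i ℕ.+ χ m i) (s i) (suc (s i ℕ.+ a i))) ∎
    where
    open ≡-Reasoning
    s : Fin (suc N) → ℕ
    s = prefixSum a
    b : Fin (suc N) → Fin (suc N) → ℕ
    b = astar (suc N) m a
    first second : Fin (suc N) → Fin (suc N) → ℤ
    first  i j = qProd (a i) (s j) (s i)
    second i j = qProd (b i j) (s i) (suc (s j))
    split : ∀ i j → (if toℕ i <ᵇ toℕ j then first i j * second i j else 1ℤ)
                    ≡ (if toℕ i <ᵇ toℕ j then first i j else 1ℤ) * (if toℕ i <ᵇ toℕ j then second i j else 1ℤ)
    split i j with toℕ i <ᵇ toℕ j
    ... | true  = refl
    ... | false = refl
    row : ∀ i → Π (λ j → if toℕ i <ᵇ toℕ j then second i j else 1ℤ) ≡ qProd (suffixSum a i ℕ.+ χ m i) (s i) (suc (s i ℕ.+ a i))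
    row i = begin
      Π (λ j → if toℕ i <ᵇ toℕ j then qProd (b i j) (s i) (suc (s j)) else 1ℤ)
        -- No prefix sum includes the last entry, the only one in which `b i` may differ from `a`.
        -- Hence the starts `s j` are also the prefix sums of `b i`, and the intervals of lengths
        -- `b i j` are adjacent.
        ≡⟨ Π-cong (λ j → cong (λ v → if toℕ i <ᵇ toℕ j then qProd (b i j) (s i) (suc v) else 1ℤ) (sym (prefixSum-bump (χ m i) a j))) ⟩
      Π (λ j → if toℕ i <ᵇ toℕ j then qProd (b i j) (s i) (1 ℕ.+ prefixSum (b i) j) else 1ℤ)
        ≡⟨ Π-qProd-above (b i) i (s i) 1 ⟩
      qProd (suffixSum (b i) i) (s i) (1 ℕ.+ prefixSum (b i) i ℕ.+ b i i)
        ≡⟨ cong₂ (λ u v → qProd u (s i) (suc v)) (suffixSum-astar m≤N a i) (cong₂ ℕ._+_ (prefixSum-bump (χ m i) a i) (astar-diagonal m≤N a i)) ⟩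
      qProd (suffixSum a i ℕ.+ χ m i) (s i) (suc (s i ℕ.+ a i)) ∎

  lhsValue-zero : ∀ n m a α i j → toℕ i ℕ.< toℕ j →
                  qProd (a i) (α j) (α i) * qProd (astar n m a i j) (α i) (suc (α j)) ≡ 0ℤ → lhsValue n m a α ≡ 0ℤ
  lhsValue-zero n m a α i j i<j eq =
    Π-zero _ i (Π-zero _ j (trans (cong (if_then qProd (a i) (α j) (α i) * qProd (astar n m a i j) (α i) (suc (α j)) else 1ℤ) (dec-true (toℕ i ℕ.<? toℕ j) i<j)) eq))

  -- The contrapositive, available because equality in ℤ is decidable: at a point of nonzero value
  -- no factor vanishes, which gives the hypotheses of `packing-unique`.
  lhsValue-support : ∀ {N m} → m ℕ.≤ N → (a α : Fin (suc N) → ℕ) →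
                     (∀ i → α i ℕ.≤ prefixSum a i ℕ.+ (suffixSum a i ℕ.+ χ m i)) →
                     ¬ (∀ i → α i ≡ prefixSum a i) → lhsValue (suc N) m a α ≡ 0ℤ
  lhsValue-support {N} {m} m≤N a α α≤d α≢s with lhsValue (suc N) m a α ℤ.≟ 0ℤ
  ... | yes eq  = eq
  ... | no  ≢0 = ⊥-elim (α≢s (Packing.packing-unique a α m (astar (suc N) m a) m≤N (a≤astar m≤N a) (astar-top m≤N a)
      ascent descent bounded))
    where
    ascent : ∀ i j → toℕ i ℕ.< toℕ j → α i ℕ.≤ α j → α i ℕ.+ a i ℕ.≤ α j
    ascent i j i<j αi≤αj = ℕ.≮⇒≥ λ αj< → ≢0 (lhsValue-zero (suc N) m a α i j i<j
      (cong (_* qProd (astar (suc N) m a i j) (α i) (suc (α j))) (qProd-zero (a i) αi≤αj αj<)))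
    descent : ∀ i j → toℕ i ℕ.< toℕ j → α j ℕ.< α i → suc (α j ℕ.+ astar (suc N) m a i j) ℕ.≤ α i
    descent i j i<j αj<αi = ℕ.≮⇒≥ λ αi< → ≢0 (lhsValue-zero (suc N) m a α i j i<j
      (trans (cong (qProd (a i) (α j) (α i) *_) (qProd-zero (astar (suc N) m a i j) αj<αi αi<)) (ℤ.*-zeroʳ (qProd (a i) (α j) (α i)))))
    rearrange : ∀ p s c x → p ℕ.+ (s ℕ.+ c) ℕ.+ x ≡ p ℕ.+ (x ℕ.+ s) ℕ.+ c
    rearrange = ℕ-solve-∀
    bounded : ∀ i → α i ℕ.+ a i ℕ.≤ Σ a ℕ.+ χ m i
    bounded i = begin
      α i ℕ.+ a i                                              ≤⟨ ℕ.+-monoˡ-≤ (a i) (α≤d i) ⟩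
      prefixSum a i ℕ.+ (suffixSum a i ℕ.+ χ m i) ℕ.+ a i      ≡⟨ rearrange (prefixSum a i) (suffixSum a i) (χ m i) (a i) ⟩
      prefixSum a i ℕ.+ (a i ℕ.+ suffixSum a i) ℕ.+ χ m i      ≡⟨ cong (ℕ._+ χ m i) (prefix+suffix a i) ⟩
      Σ a ℕ.+ χ m i                                            ∎
      where open ℕ.≤-Reasoning

  -- Telescoping at the surviving point and values of the q-factorials

  telescope₀ : ∀ {n} (a : Fin n → ℕ) →
               Π (λ i → qProd (a i ℕ.+ (suffixSum a i ℕ.+ 0)) 0 1) ≡ qProd (Σ a) 0 1 * Π (λ i → qProd (suffixSum a i ℕ.+ 0) 0 1)
  telescope₀ {zero}  a = refl
  telescope₀ {suc n} a rewrite ℕ.+-identityʳ (Σ (a ∘ suc)) = cong (qProd (Σ a) 0 1 *_) (telescope₀ (a ∘ suc))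

  -- `a i + suffixSum a i` is the suffix sum of the preceding index, so neighbouring factors (q)_k
  -- cancel as long as χ is constant. The start leaves (q)_{|a|+1}. Where χ drops from 1 to 0,
  -- (q)_{S+1} meets (q)_S with S = ∑_{v>m} a_v, which leaves the denominator 1 - q^(1+S). For m = 0
  -- the two extra factors coincide.
  telescope : ∀ {n} m (a : Fin n → ℕ) →
              Π (λ i → qProd (a i ℕ.+ (suffixSum a i ℕ.+ χ m i)) 0 1) * (1ℤ - Q ^ suc (Σ (λ v → if toℕ v <ᵇ m then 0 else a v)))
              ≡ (1ℤ - Q ^ suc (Σ a)) * qProd (Σ a) 0 1 * Π (λ i → qProd (suffixSum a i ℕ.+ χ m i) 0 1)
  telescope zero a = trans (cong (_* (1ℤ - Q ^ suc (Σ a))) (telescope₀ a))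
                           (rotate (qProd (Σ a) 0 1) (Π (λ i → qProd (suffixSum a i ℕ.+ 0) 0 1)) (1ℤ - Q ^ suc (Σ a)))
    where
    rotate : ∀ x y z → x * y * z ≡ z * x * y
    rotate = solve-∀
  telescope {zero}  (suc m) a = rotate (1ℤ - Q ^ 1)
    where
    rotate : ∀ x → 1ℤ * x ≡ x * 1ℤ * 1ℤ
    rotate = solve-∀
  telescope {suc n} (suc m) a rewrite ℕ.+-comm (Σ (a ∘ suc)) 1 | ℕ.+-suc (a zero) (Σ (a ∘ suc)) = begin
    X * x * Y * t                ≡⟨ ℤ.*-assoc (X * x) Y t ⟩
    X * x * (Y * t)              ≡⟨ cong (X * x *_) (telescope m (a ∘ suc)) ⟩
    X * x * (y * Z * W)          ≡⟨ rearrange X x y Z W ⟩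
    x * X * (Z * y * W)          ∎
    where
    open ≡-Reasoning
    X x Y t y Z W : ℤ
    X = qProd (Σ a) 0 1
    x = 1ℤ - Q ^ suc (Σ a)
    Y = Π (λ i → qProd (a (suc i) ℕ.+ (suffixSum (a ∘ suc) i ℕ.+ χ m i)) 0 1)
    t = 1ℤ - Q ^ suc (Σ (λ v → if toℕ v <ᵇ m then 0 else a (suc v)))
    y = 1ℤ - Q ^ suc (Σ (a ∘ suc))
    Z = qProd (Σ (a ∘ suc)) 0 1
    W = Π (λ i → qProd (suffixSum (a ∘ suc) i ℕ.+ χ m i) 0 1)
    rearrange : ∀ X x y Z W → X * x * (y * Z * W) ≡ x * X * (Z * y * W)
    rearrange = solve-∀

  evalq-oneMinusQ : ∀ k → evalq Q (oneMinusQ k) ≡ 1ℤ - Q ^ k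
  evalq-oneMinusQ k = lemma (Q ^ k)
    where
    lemma : ∀ x → 1ℤ * 1ℤ * 1ℤ + (- 1ℤ * x * 1ℤ + 0ℤ) ≡ 1ℤ - x
    lemma = solve-∀

  evalq-qPoch : ∀ k → evalq Q (qPoch k) ≡ qProd k 0 1
  evalq-qPoch zero    = refl
  evalq-qPoch (suc k) = trans (evalq-⊗ Q (qPoch k) (oneMinusQ (suc k))) (cong₂ _*_ (evalq-qPoch k) (evalq-oneMinusQ (suc k)))

  evalq-prodL : ∀ {A : Set} {n} (f : A → QPoly) (g : Fin n → A) → evalq Q (prodL (map f (tabulate g))) ≡ Π (λ i → evalq Q (f (g i)))
  evalq-prodL {n = zero}  f g = refl
  evalq-prodL {n = suc n} f g = trans (evalq-⊗ Q (f (g zero)) (prodL (map f (tabulate (g ∘ suc)))))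
                                      (cong (evalq Q (f (g zero)) *_) (evalq-prodL f (g ∘ suc)))

  -- Solving for the constant term

  module _ (Q^-injective : ∀ {x y} → Q ^ x ≡ Q ^ y → x ≡ y) where

    -- A vanishing power would equal the next one.
    power-nonzero : ∀ x → Q ^ x ≢ 0ℤ
    power-nonzero x Q^x≡0 = ℕ.1+n≢n (Q^-injective {suc x} {x} (trans (cong (Q *_) Q^x≡0) (trans (ℤ.*-zeroʳ Q) (sym Q^x≡0))))

    qProd-nonzero : ∀ k {x y} → (∀ t → t ℕ.< k → x ≢ y ℕ.+ t) → qProd k x y ≢ 0ℤ
    qProd-nonzero zero    x≢ = λ ()
    qProd-nonzero (suc k) {x} {y} x≢ eq with ℤ.i*j≡0⇒i≡0∨j≡0 (qProd k x y) eq
    ... | inj₁ qProd≡0 = qProd-nonzero k (λ t t<k → x≢ t (ℕ.m<n⇒m<1+n t<k)) qProd≡0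
    ... | inj₂ diff≡0 = x≢ k ℕ.≤-refl (Q^-injective (ℤ.i-j≡0⇒i≡j (Q ^ x) (Q ^ (y ℕ.+ k)) diff≡0))

    module _ {N m : ℕ} (m≤N : m ℕ.≤ N) (a : Fin (suc N) → ℕ) where
      private
        n : ℕ
        n = suc N
        s r d : Fin n → ℕ
        s = prefixSum a
        r i = suffixSum a i ℕ.+ χ m i
        d i = s i ℕ.+ r i

        CTq A A₀ B B₀ D E T T₀ W : ℤ
        CTq = evalq Q (CT (lhs n m a))
        A  = Π (λ i → qProd (s i) (s i) 0)
        A₀ = Π (λ i → qProd (a i) 0 1)
        B  = Π (λ i → qProd (r i) (s i) (suc (s i)))
        B₀ = Π (λ i → qProd (r i) 0 1)
        D  = Π (λ i → qProd (d i) (d i) 0)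
        E  = Π (λ i → (Q ^ s i) ^ r i)
        T  = Π (λ i → qProd (r i) (s i) (suc (s i ℕ.+ a i)))
        T₀ = Π (λ i → qProd (r i) 0 (suc (a i)))
        W  = Π (λ i → weight (d i) (s i))

        lhs-hom : Homogenised d (lhs n m a) (lhsValue n m a)
        lhs-hom = hom-cong (λ l → trans (degree-sum a (astar n m a) l) (cong (s l ℕ.+_) (suffixSum-astar m≤N a l)))
                    (λ _ → refl) (hom-lhs n m a)

        interpolation : CTq * D ≡ W * (A * T)
        interpolation = begin
          CTq * D                                            ≡⟨ boxDiff-CT d (balanced lhs-hom) ⟨
          boxDiff d (λ α → eval Q (monomial d α) (lhs n m a)) ≡⟨ boxDiff-cong d (value lhs-hom) ⟩
          boxDiff d (lhsValue n m a)                         ≡⟨ boxDiff-support d s (lhsValue n m a s)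
                                                                  (λ α → lhsValue-support m≤N a α) (λ α → lhsValue-cong n m a)
                                                                  (λ i → ℕ.m≤m+n (s i) (r i)) ⟩
          W * lhsValue n m a s                               ≡⟨ cong (W *_) (lhsValue-prefixSum m≤N a) ⟩
          W * (A * T)                                        ∎
          where open ≡-Reasoning

        weights : W * (A * B) ≡ D
        weights = begin
          W * (A * B) ≡⟨ cong (W *_) (Π-distrib-* (λ i → qProd (s i) (s i) 0) (λ i → qProd (r i) (s i) (suc (s i)))) ⟨
          W * Π (λ i → qProd (s i) (s i) 0 * qProd (r i) (s i) (suc (s i)))
            ≡⟨ Π-distrib-* (λ i → weight (d i) (s i)) (λ i → qProd (s i) (s i) 0 * qProd (r i) (s i) (suc (s i))) ⟨
          Π (λ i → weight (d i) (s i) * (qProd (s i) (s i) 0 * qProd (r i) (s i) (suc (s i))))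
            ≡⟨ Π-cong (λ i → weight-value (s i) (r i)) ⟩
          D ∎
          where open ≡-Reasoning

        D≢0 : D ≢ 0ℤ
        D≢0 = Π-nonzero _ (λ i → qProd-nonzero (d i) (λ t t<d → ℕ.>⇒≢ t<d))

        E≢0 : E ≢ 0ℤ
        E≢0 = Π-nonzero _ (λ i eq → power-nonzero (s i) (ℤ.i^n≡0⇒i≡0 (Q ^ s i) (r i) eq))

        B₀≢0 : B₀ ≢ 0ℤ
        B₀≢0 = Π-nonzero _ (λ i → qProd-nonzero (r i) {0} {1} (λ t _ ()))

        qProd-homogeneous : ∀ i y → qProd (r i) (s i) (s i ℕ.+ y) ≡ (Q ^ s i) ^ r i * qProd (r i) 0 y
        qProd-homogeneous i y = trans (cong (λ x → qProd (r i) x (s i ℕ.+ y)) (sym (ℕ.+-identityʳ (s i)))) (qProd-shift (s i) (r i) 0 y)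

        B-factor : B ≡ E * B₀
        B-factor = trans (Π-cong (λ i → trans (cong (qProd (r i) (s i)) (ℕ.+-comm 1 (s i))) (qProd-homogeneous i 1)))
                         (Π-distrib-* (λ i → (Q ^ s i) ^ r i) (λ i → qProd (r i) 0 1))

        T-factor : T ≡ E * T₀
        T-factor = trans (Π-cong (λ i → trans (cong (qProd (r i) (s i)) (sym (ℕ.+-suc (s i) (a i)))) (qProd-homogeneous i (suc (a i)))))
                         (Π-distrib-* (λ i → (Q ^ s i) ^ r i) (λ i → qProd (r i) 0 (suc (a i))))

        -- `interpolation` and `weights` share `W * A` and `D`; eliminating these gives
        -- `CTq * B ≡ T`. The powers of q extracted from `B` and `T` are the same product `E`, since
        -- both have `r i` factors in coordinate i.
        CT-B₀ : CTq * B₀ ≡ T₀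
        CT-B₀ = *-cancel E≢0 (*-cancel D≢0 (begin
          CTq * B₀ * E * D       ≡⟨ pull CTq B₀ E D ⟩
          CTq * D * (E * B₀)     ≡⟨ cong₂ _*_ interpolation (sym B-factor) ⟩
          W * (A * T) * B        ≡⟨ swap W A T B ⟩
          T * (W * (A * B))      ≡⟨ cong₂ _*_ T-factor weights ⟩
          E * T₀ * D             ≡⟨ cong (_* D) (ℤ.*-comm E T₀) ⟩
          T₀ * E * D             ∎))
          where
          open ≡-Reasoning
          pull : ∀ c b e d → c * b * e * d ≡ c * d * (e * b)
          pull = solve-∀
          swap : ∀ w a t b → w * (a * t) * b ≡ t * (w * (a * b))
          swap = solve-∀

        -- The denominators (q)_{a_i} of the multinomial coefficient are the initial segments
        -- missing from the products in `T₀`.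
        A₀-T₀ : A₀ * T₀ ≡ Π (λ i → qProd (a i ℕ.+ r i) 0 1)
        A₀-T₀ = trans (sym (Π-distrib-* (λ i → qProd (a i) 0 1) (λ i → qProd (r i) 0 (suc (a i)))))
                      (Π-cong (λ i → sym (qProd-+ (a i) (r i) 0 1)))

      CT-formula : evalq Q (CT (lhs (suc N) m a)) * ((1ℤ - Q ^ suc (Σ (λ v → if toℕ v <ᵇ m then 0 else a v))) * Π (λ i → qProd (a i) 0 1))
                   ≡ (1ℤ - Q ^ suc (Σ a)) * qProd (Σ a) 0 1
      CT-formula = *-cancel B₀≢0 (begin
        CTq * (t * A₀) * B₀                           ≡⟨ pull CTq t A₀ B₀ ⟩
        A₀ * (CTq * B₀) * t                           ≡⟨ cong (λ v → A₀ * v * t) CT-B₀ ⟩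
        A₀ * T₀ * t                                   ≡⟨ cong (_* t) A₀-T₀ ⟩
        Π (λ i → qProd (a i ℕ.+ r i) 0 1) * t            ≡⟨ telescope m a ⟩
        (1ℤ - Q ^ suc (Σ a)) * qProd (Σ a) 0 1 * B₀      ∎)
        where
        open ≡-Reasoning
        t : ℤ
        t = 1ℤ - Q ^ suc (Σ (λ v → if toℕ v <ᵇ m then 0 else a v))
        pull : ∀ c t a b → c * (t * a) * b ≡ a * (c * b) * t
        pull = solve-∀

-- From integer values of q to the polynomial identity

+-^ : ∀ b x → (+ b) ^ x ≡ + (b ℕ.^ x)
+-^ b zero    = refl
+-^ b (suc x) = trans (cong (+ b *_) (+-^ b x)) (sym (ℤ.pos-* b (b ℕ.^ x)))

^-injective : ∀ z {x y} → (+ (2 ℕ.+ z)) ^ x ≡ (+ (2 ℕ.+ z)) ^ y → x ≡ y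
^-injective z {x} {y} eq with ℕ.<-cmp x y
... | tri≈ _ x≡y _ = x≡y
... | tri< x<y _ _ = ⊥-elim (ℕ.<⇒≢ (ℕ.^-monoʳ-< (2 ℕ.+ z) (ℕ.s≤s ℕ.z<s) x<y) (ℤ.+-injective (trans (sym (+-^ (2 ℕ.+ z) x)) (trans eq (+-^ (2 ℕ.+ z) y)))))
... | tri> _ _ y<x = ⊥-elim (ℕ.>⇒≢ (ℕ.^-monoʳ-< (2 ℕ.+ z) (ℕ.s≤s ℕ.z<s) y<x) (ℤ.+-injective (trans (sym (+-^ (2 ℕ.+ z) x)) (trans eq (+-^ (2 ℕ.+ z) y)))))

theorem5 : (n m : ℕ) → 1 ≤ n → m < n → (a : Fin n → ℕ) → (k : ℕ) →
    qcoeff (CT (lhs n m a) ⊗ (oneMinusQ (suc (tailSum m a)) ⊗ prodL (map (λ i → qPoch (a i)) (allFin n)))) k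
    ≡ qcoeff (oneMinusQ (suc ∣ a ∣) ⊗ qPoch ∣ a ∣) k
theorem5 (suc N) m _ (ℕ.s≤s m≤N) a = evalq-injective
  (CT (lhs (suc N) m a) ⊗ (oneMinusQ (suc (tailSum m a)) ⊗ prodL (map (λ i → qPoch (a i)) (allFin (suc N)))))
  (oneMinusQ (suc ∣ a ∣) ⊗ qPoch ∣ a ∣)
  (λ z → evaluated (+ (2 ℕ.+ z)) (^-injective z))
  where
  evaluated : ∀ Q → (∀ {x y} → Q ^ x ≡ Q ^ y → x ≡ y) →
    evalq Q (CT (lhs (suc N) m a) ⊗ (oneMinusQ (suc (tailSum m a)) ⊗ prodL (map (λ i → qPoch (a i)) (allFin (suc N)))))
    ≡ evalq Q (oneMinusQ (suc ∣ a ∣) ⊗ qPoch ∣ a ∣)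
  evaluated Q Q^-injective = begin
    evalq Q (p ⊗ (t ⊗ u))                    ≡⟨ evalq-⊗ Q p (t ⊗ u) ⟩
    evalq Q p * evalq Q (t ⊗ u)              ≡⟨ cong (evalq Q p *_) (evalq-⊗ Q t u) ⟩
    evalq Q p * (evalq Q t * evalq Q u)      ≡⟨ cong (evalq Q p *_) (cong₂ _*_ t-value u-value) ⟩
    evalq Q p * ((1ℤ - Q ^ suc (Σ (λ v → if toℕ v <ᵇ m then 0 else a v))) * Π (λ i → qProd (a i) 0 1))
                                             ≡⟨ CT-formula Q^-injective m≤N a ⟩
    (1ℤ - Q ^ suc (Σ a)) * qProd (Σ a) 0 1      ≡⟨ cong (λ v → (1ℤ - Q ^ suc v) * qProd v 0 1) (∣∣-Σ a) ⟨
    (1ℤ - Q ^ suc ∣ a ∣) * qProd ∣ a ∣ 0 1      ≡⟨ cong₂ _*_ (evalq-oneMinusQ (suc ∣ a ∣)) (evalq-qPoch ∣ a ∣) ⟨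
    evalq Q (oneMinusQ (suc ∣ a ∣)) * evalq Q (qPoch ∣ a ∣) ≡⟨ evalq-⊗ Q (oneMinusQ (suc ∣ a ∣)) (qPoch ∣ a ∣) ⟨
    evalq Q (oneMinusQ (suc ∣ a ∣) ⊗ qPoch ∣ a ∣) ∎
    where
    open ≡-Reasoning
    open Interpolation Q using (qProd)
    open Products Q
    p t u : QPoly
    p = CT (lhs (suc N) m a)
    t = oneMinusQ (suc (tailSum m a))
    u = prodL (map (λ i → qPoch (a i)) (allFin (suc N)))
    t-value : evalq Q t ≡ 1ℤ - Q ^ suc (Σ (λ v → if toℕ v <ᵇ m then 0 else a v))
    t-value = trans (evalq-oneMinusQ (suc (tailSum m a))) (cong (λ v → 1ℤ - Q ^ suc v) (tailSum-Σ m a))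
    u-value : evalq Q u ≡ Π (λ i → qProd (a i) 0 1)
    u-value = trans (evalq-prodL (λ i → qPoch (a i)) (λ i → i)) (Π-cong (λ i → evalq-qPoch (a i)))
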